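{- Let $m$ be a positive integer, $q=2^m$, and $\delta\in\mathbb{F}_{q^3}$. Put $A=\mathrm{Tr}_m^{3m}(\delta^{2+q}+\delta^{2+q^2}+1)$, $B=\mathrm{Tr}_m^{3m}(\delta^2+\delta^{1+q})$ and $D=\delta^{q^2+q+1}\mathrm{Tr}_m^{3m}(\delta)$. Assume that $$f(x)=\left(\mathrm{Tr}_m^{3m}(x)+\delta\right)^{q^2+q+2}+x$$ permutes $\mathbb{F}_{q^3}$. Then: (1) If $A=0$ and $B=0$, the compositional inverse of $f$ over $\mathbb{F}_{q^3}$ is $f^{ -1}(x)=x+\left((\mathrm{Tr}_m^{3m}(x)+D)^{q/4}+\delta\right)^{q^2+q+2}$. (2) If $B=0$ and $A\neq0$ is not a cube of an element of $\mathbb{F}_q$, then, with $d=\gcd(m,2)$ and $N=N_{2^m/2^d}(A)=A^{(2^m-1)/(2^d-1)}$, the compositional inverse of $f$ over $\mathbb{F}_{q^3}$ is $$f^{ -1}(x)=x+\left(\delta+\frac{N}{1+N}\sum_{i=0}^{m/d-1}A^{ -\frac{4^{i+1}-1}{3}}\left(\mathrm{Tr}_m^{3m}(x)+D\right)^{4^i}\right)^{q^2+q+2}.$$ (3) If $AB\neq0$, let $S_{ -1}=0$, $S_0=1$, $S_i=B^{2^{i-1}}S_{i-1}+A^{2^{i-1}}S_{i-2}$ for $i\ge1$. Then the compositional inverse of $f$ over $\mathbb{F}_{q^3}$ is $$f^{ -1}(x)=x+\left(\delta+\sum_{i=0}^{m-1}\left(S_{m-2-i}^{2^{i+1}}+A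^{1-2^{i+1}}S_i\right)\left(\mathrm{Tr}_m^{3m}(x)+D\right)^{2^i}\right)^{q^2+q+2}.$$
   Context: $\mathrm{Tr}_m^{3m}(x)=x+x^{q}+x^{q^2}$ is the trace map from $\mathbb{F}_{q^3}$ to $\mathbb{F}_q$. For $d\mid m$, $N_{2^m/2^d}(a)=a^{(2^m-1)/(2^d-1)}$ is the norm from $\mathbb{F}_{2^m}$ to $\mathbb{F}_{2^d}$. The exponent $q/4$ denotes $2^{m-2}$. The compositional inverse of a permutation polynomial $F$ of $\mathbb{F}_{q^3}$ is the unique polynomial map $F^{ -1}$ with $F(F^{ -1}(x))=F^{ -1}(F(x))=x$ for all $x\in\mathbb{F}_{q^3}$. -}

module Defs where

open import Level using (Level; _⊔_)
open import Data.Nat using (ℕ; zero; suc; _∸_; _/_) renaming (_^_ to _^ℕ_)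
open import Data.Nat.GCD using (gcd)
open import Data.Fin using (Fin)
open import Data.Product using (Σ; _×_)
open import Relation.Nullary using (¬_)
open import Relation.Binary.PropositionalEquality as ≡ using ()
open import Function.Bundles using (Bijection)
open import Function.Definitions using (Bijective)
open import Algebra.Bundles using (CommutativeRing; Semiring)
import Algebra.Definitions.RawSemiring as RS

-- natural-number division, only ever used with a nonzero divisor
divBy : ℕ → ℕ → ℕ
divBy n zero    = 0
divBy n (suc k) = n / suc k

module Ops {c ℓ : Level} (R : CommutativeRing c ℓ) where
  open CommutativeRing R public

  record IsField : Set (c ⊔ ℓ) where
    field
      inv      : Carrier → Carrier
      inverseʳ : ∀ x → ¬ (x ≈ 0#) → (x * inv x) ≈ 1#
      0≉1      : ¬ (0# ≈ 1#)

  HasCard : ℕ → Set (c ⊔ ℓ)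
  HasCard n = Bijection setoid (≡.setoid (Fin n))

  open RS (Semiring.rawSemiring semiring) public using (_^_)

  sumTo : ℕ → (ℕ → Carrier) → Carrier
  sumTo zero    g = 0#
  sumTo (suc n) g = sumTo n g + g n

  Permutes : (Carrier → Carrier) → Set (c ⊔ ℓ)
  Permutes f = Bijective _≈_ _≈_ f

  IsCompInverse : (Carrier → Carrier) → (Carrier → Carrier) → Set (c ⊔ ℓ)
  IsCompInverse f g = (∀ x → f (g x) ≈ x) × (∀ x → g (f x) ≈ x)

  Tr : ℕ → Carrier → Carrier
  Tr m x = x + x ^ (2 ^ℕ m) + x ^ ((2 ^ℕ m) ^ℕ 2)

  InFq : ℕ → Carrier → Set ℓ
  InFq m y = y ^ (2 ^ℕ m) ≈ y

  -- Shifted recurrence: Sshift A B n = S_{n-1}, where S_{-1} = 0, S_0 = 1,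
  -- S_i = B^{2^{i-1}} S_{i-1} + A^{2^{i-1}} S_{i-2}  (i ≥ 1)
  Sshift : Carrier → Carrier → ℕ → Carrier
  Sshift A B zero = 0#
  Sshift A B (suc zero) = 1#
  Sshift A B (suc (suc n)) = B ^ (2 ^ℕ n) * Sshift A B (suc n) + A ^ (2 ^ℕ n) * Sshift A B n

{-# OPTIONS --safe #-}

-- For t in F_q, expanding the product of the conjugates of t + δ gives
-- Tr ((t + δ)^e) + t + D = L(t), where L(t) = t⁴ + B t² + A t.  Hence Tr (f x) + D = L(Tr x), and
-- f is inverted by any G with G(L(t)) = t on F_q: from y = f x one reads off Tr x = G(Tr y + D), and
-- then x = y + (δ + Tr x)^e.
--
-- Each G below is a linearised polynomial for which the sum G(L(t)) telescopes, leaving λ t with a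
-- constant λ.  It remains to see that λ ≠ 0.  As f permutes, L maps F_q onto itself, so λ = 0 would
-- make G vanish on F_q; composing with Tr, a polynomial of degree below |F| would vanish on all of
-- F, and the coefficients of G would be 0.
module Submission where

open import Defs
open import Level using (Level; _⊔_)
open import Data.Nat using (ℕ; zero; suc; _≤_; _<_; s≤s; z≤n)
  renaming (_+_ to _+ℕ_; _*_ to _*ℕ_; _^_ to _^ℕ_; _∸_ to _∸ℕ_)
open import Data.Nat.GCD using (gcd; gcd[m,n]∣n; gcd-greatest)
open import Data.Product using (Σ; _×_; _,_; proj₁; proj₂)
open import Relation.Nullary using (¬_; Dec; yes; no; contradiction)
open import Algebra.Bundles using (CommutativeRing; CommutativeMonoid; RawRing)
import Algebra.Properties.CommutativeMonoid.Sum as Sum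
import Algebra.Properties.CommutativeSemiring.Exp as Exp
import Algebra.Properties.Group as Group
import Algebra.Properties.Semiring.Mult as Mult
import Algebra.Solver.Ring
open import Algebra.Solver.Ring.AlmostCommutativeRing
  using (AlmostCommutativeRing; _-Raw-AlmostCommutative⟶_; fromCommutativeSemiring)
open import Data.Bool.Base using (Bool; true; false; _xor_; _∧_)
open import Data.Fin using (Fin; zero; suc; inject≤)
open import Data.Fin.Permutation using (Permutation′; permutation)
import Data.Fin.Properties as Fin
open import Data.Maybe.Base using (Maybe; just; nothing)
import Data.Nat as ℕ
open import Data.Nat.Divisibility using (∣-antisym; ∣-refl; n∣m*n)
import Data.Nat.DivMod as ℕ
import Data.Nat.Properties as ℕ
open import Data.Nat.Tactic.RingSolver using (solve-∀)
open import Data.Sum using (_⊎_; inj₁; inj₂)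
open import Data.Vec.Functional using (replicate; removeAt)
open import Function.Base using (id)
open import Function.Bundles using (Bijection)
import Relation.Binary.Reasoning.Setoid as SetoidReasoning
open import Relation.Binary.PropositionalEquality as ≡ using (_≡_)
open import Relation.Nullary.Decidable using (map′)

-- Finite fields

-- F is given only by its cardinality, and F_q only as the solutions of y^q = y, with no enumeration
-- of its own. Roots are therefore counted in F, and this is why `Tr` is composed with G: each
-- coefficient of G then recurs at three distinct exponents. The constants are as follows. In (1) λ
-- is 1 at once. In (2) the bare sum leaves 1 + 1/N, the reciprocal of the factor in front of it; if
-- this were 0, so would be the coefficient 1/A of the sum. That A is not a cube excludes odd m,
-- hence d = 2. In (3) λ = S_m + A S_{m-2}² is idempotent, so λ ≠ 0 already gives λ = 1. No
-- coefficient of G is visibly non-zero there, which is why the contradiction has to be drawn from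
-- one half of G.

module FiniteField {c ℓ : Level} (F : CommutativeRing c ℓ) (isF : Ops.IsField F)
                   (n : ℕ) (card : Ops.HasCard F n) where
  open Ops F hiding (zero)
  open IsField isF
  open Mult semiring using (×1-homo-*) renaming (_×_ to _·_)
  open SetoidReasoning setoid

  private module C = Bijection card

  point : Fin n → Carrier
  point i = proj₁ (C.strictlySurjective i)

  to-point : ∀ i → C.to (point i) ≡ i
  to-point i = proj₂ (C.strictlySurjective i)

  point-to : ∀ x → point (C.to x) ≈ x
  point-to x = C.injective (to-point (C.to x))

  point-injective : ∀ {i j} → point i ≈ point j → i ≡ j
  point-injective {i} {j} p =
    ≡.trans (≡.sym (to-point i)) (≡.trans (C.cong p) (to-point j))

  infix 4 _≟_
  _≟_ : ∀ x y → Dec (x ≈ y)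
  x ≟ y = map′ C.injective C.cong (C.to x Fin.≟ C.to y)

  *-cancelˡ-0 : ∀ {x y} → ¬ (x ≈ 0#) → x * y ≈ 0# → y ≈ 0#
  *-cancelˡ-0 {x} {y} x≉0 xy≈0 = begin
    y                ≈⟨ *-identityˡ y ⟨
    1# * y           ≈⟨ *-congʳ (inverseʳ x x≉0) ⟨
    x * inv x * y    ≈⟨ *-congʳ (*-comm x (inv x)) ⟩
    inv x * x * y    ≈⟨ *-assoc _ _ _ ⟩
    inv x * (x * y)  ≈⟨ *-congˡ xy≈0 ⟩
    inv x * 0#       ≈⟨ zeroʳ _ ⟩
    0#               ∎

  *-cancelˡ-1 : ∀ {x y} → ¬ (x ≈ 0#) → y * x ≈ x → y ≈ 1#
  *-cancelˡ-1 {x} {y} x≉0 yx≈x = begin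
    y                ≈⟨ *-identityʳ y ⟨
    y * 1#           ≈⟨ *-congˡ (inverseʳ x x≉0) ⟨
    y * (x * inv x)  ≈⟨ *-assoc _ _ _ ⟨
    y * x * inv x    ≈⟨ *-congʳ yx≈x ⟩
    x * inv x        ≈⟨ inverseʳ x x≉0 ⟩
    1#               ∎

  ^≉0 : ∀ {x} → ¬ (x ≈ 0#) → ∀ k → ¬ (x ^ k ≈ 0#)
  ^≉0 x≉0 zero    p = 0≉1 (sym p)
  ^≉0 x≉0 (suc k) p = ^≉0 x≉0 k (*-cancelˡ-0 x≉0 p)

  x^k≈0⇒x≈0 : ∀ x k → x ^ k ≈ 0# → x ≈ 0#
  x^k≈0⇒x≈0 x k p with x ≟ 0#
  ... | yes x≈0 = x≈0
  ... | no x≉0  = contradiction p (^≉0 x≉0 k)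

  module _ {m ℓm} (M : CommutativeMonoid m ℓm) where
    private module M = CommutativeMonoid M
    open Sum M using (sum; sum-permute; sum-cong-≋)

    -- The bijection σ, with inverse τ, becomes a permutation of the indices. The monoid is
    -- arbitrary because both the additive and the multiplicative one are needed.
    sum-invariant : (h : Carrier → M.Carrier) → (∀ {x y} → x ≈ y → h x M.≈ h y) →
                    (σ τ : Carrier → Carrier) →
                    (∀ {x y} → x ≈ y → σ x ≈ σ y) → (∀ {x y} → x ≈ y → τ x ≈ τ y) →
                    (∀ x → σ (τ x) ≈ x) → (∀ x → τ (σ x) ≈ x) →
                    sum (λ i → h (point i)) M.≈ sum (λ i → h (σ (point i)))
    sum-invariant h h-cong σ τ σ-cong τ-cong στ τσ =
      M.trans (sum-permute (λ i → h (point i)) π)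
              (sum-cong-≋ λ i → h-cong (point-to (σ (point i))))
      where
      inverse : ∀ {σ τ : Carrier → Carrier} → (∀ {x y} → x ≈ y → σ x ≈ σ y) →
                (∀ x → σ (τ x) ≈ x) → ∀ i → C.to (σ (point (C.to (τ (point i))))) ≡ i
      inverse σ-cong στ i =
        ≡.trans (C.cong (trans (σ-cong (point-to _)) (στ (point i)))) (to-point i)
      π : Permutation′ n
      π = permutation (λ i → C.to (σ (point i))) (λ i → C.to (τ (point i)))
            (inverse {σ} {τ} σ-cong στ) (inverse {τ} {σ} τ-cong τσ)

  -- Translation by 1 permutes F, so Σ x = Σ (x + 1) = Σ x + n.
  n·1≈0 : n · 1# ≈ 0#
  n·1≈0 = begin
    n · 1#                       ≈⟨ S.sum-replicate n ⟨
    S.sum (replicate n 1#)       ≈⟨ G.identityʳ-unique _ _ (begin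
      S.sum point + S.sum (replicate n 1#)  ≈⟨ S.∑-distrib-+ point (replicate n 1#) ⟨
      S.sum (λ i → point i + 1#)            ≈⟨ sum-invariant +-commutativeMonoid id id (_+ 1#) (_+ (- 1#))
                                                 +-congʳ +-congʳ (cancel (-‿inverseˡ 1#)) (cancel (-‿inverseʳ 1#)) ⟨
      S.sum point                           ∎) ⟩
    0#                           ∎
    where
    module S = Sum +-commutativeMonoid
    module G = Group +-group
    cancel : ∀ {u v} → u + v ≈ 0# → ∀ x → (x + u) + v ≈ x
    cancel uv≈0 x = trans (+-assoc _ _ _) (trans (+-congˡ uv≈0) (+-identityʳ x))

  -- `n·1≈0` becomes (1 + 1)^k = 0, and a field has no nilpotent elements except 0.
  2^k-card⇒1+1≈0 : ∀ k → n ≡ 2 ^ℕ k → 1# + 1# ≈ 0#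
  2^k-card⇒1+1≈0 k n≡2^k = x^k≈0⇒x≈0 _ k (begin
    (1# + 1#) ^ k   ≈⟨ 2^k·1 k ⟨
    (2 ^ℕ k) · 1#   ≡⟨ ≡.cong (_· 1#) n≡2^k ⟨
    n · 1#          ≈⟨ n·1≈0 ⟩
    0#              ∎)
    where
    2^k·1 : ∀ k → (2 ^ℕ k) · 1# ≈ (1# + 1#) ^ k
    2^k·1 zero    = +-identityʳ 1#
    2^k·1 (suc k) = trans (×1-homo-* 2 (2 ^ℕ k))
      (*-cong (+-congˡ (+-identityʳ 1#)) (2^k·1 k))

  private
    module P = Sum *-commutativeMonoid

    ifZero : Carrier → Carrier → Carrier → Carrier
    ifZero u v x with x ≟ 0#
    ... | yes _ = u
    ... | no _  = v

    ifZero-0 : ∀ {u v x} → x ≈ 0# → ifZero u v x ≈ u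
    ifZero-0 {x = x} x≈0 with x ≟ 0#
    ... | yes _  = refl
    ... | no x≉0 = contradiction x≈0 x≉0

    ifZero-≉0 : ∀ {u v x} → ¬ (x ≈ 0#) → ifZero u v x ≈ v
    ifZero-≉0 {x = x} x≉0 with x ≟ 0#
    ... | yes x≈0 = contradiction x≈0 x≉0
    ... | no _    = refl

    prod-≉0 : ∀ {k} (t : Fin k → Carrier) → (∀ i → ¬ (t i ≈ 0#)) → ¬ (P.sum t ≈ 0#)
    prod-≉0 {zero}  t t≉0 p = 0≉1 (sym p)
    prod-≉0 {suc k} t t≉0 p =
      prod-≉0 (λ i → t (suc i)) (λ i → t≉0 (suc i)) (*-cancelˡ-0 (t≉0 zero) p)

    prod-replicate-1 : ∀ {k} (t : Fin k → Carrier) → (∀ i → t i ≈ 1#) → P.sum t ≈ 1#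
    prod-replicate-1 {k} t t≈1 = trans (P.sum-cong-≋ t≈1) (P.sum-replicate-zero k)

    prod-single : ∀ {k} (t : Fin k → Carrier) j → (∀ i → ¬ (i ≡ j) → t i ≈ 1#) → P.sum t ≈ t j
    prod-single {suc k} t j t≈1 = trans (P.sum-remove {i = j} t)
      (trans (*-congˡ (prod-replicate-1 (removeAt t j) (λ i → t≈1 _ (Fin.punchInᵢ≢i j i))))
             (*-identityʳ _))

  -- Multiplication by a ≉ 0 permutes F.  Writing u x for x when x ≉ 0 and for 1 when x ≈ 0, the
  -- products of u x and of u (a x) agree, and a · u x = u (a x) · (a if x ≈ 0, else 1).
  x^n≈x : ∀ a → a ^ n ≈ a
  x^n≈x a with a ≟ 0#
  ... | yes a≈0 = trans (0^ (C.to a)) (sym a≈0)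
    where
    -- The inhabitant of `Fin k` shows k > 0; at k = 0 the power would be 1.
    0^ : ∀ {k} → Fin k → a ^ k ≈ 0#
    0^ {suc k} _ = trans (*-congʳ a≈0) (zeroˡ _)
  ... | no a≉0 = begin
    a ^ n                                                  ≈⟨ P.sum-replicate n ⟨
    P.sum (replicate n a)                                  ≈⟨ cancelProd ⟩
    -- Every factor is 1 except the one at the index of 0.
    P.sum (λ i → w (point i))                              ≈⟨ prod-single _ (C.to 0#)
                                                                (λ i i≢0 → ifZero-≉0 λ p → i≢0
                                                                  (≡.trans (≡.sym (to-point i)) (C.cong p))) ⟩
    w (point (C.to 0#))                                    ≈⟨ ifZero-0 (point-to 0#) ⟩
    a                                                      ∎
    where
    u w : Carrier → Carrier
    u x = ifZero 1# x x
    w x = ifZero a 1# x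
    u≉0 : ∀ x → ¬ (u x ≈ 0#)
    u≉0 x with x ≟ 0#
    ... | yes _  = λ p → 0≉1 (sym p)
    ... | no x≉0 = x≉0
    u-cong : ∀ {x y} → x ≈ y → u x ≈ u y
    u-cong {x} {y} x≈y with x ≟ 0#
    ... | yes x≈0 = sym (ifZero-0 (trans (sym x≈y) x≈0))
    ... | no x≉0  = trans x≈y (sym (ifZero-≉0 λ y≈0 → x≉0 (trans x≈y y≈0)))
    au : ∀ x → a * u x ≈ w x * u (a * x)
    au x with x ≟ 0#
    ... | yes x≈0 = *-congˡ (sym (ifZero-0 (trans (*-congˡ x≈0) (zeroʳ a))))
    ... | no x≉0  = trans (sym (ifZero-≉0 λ p → x≉0 (*-cancelˡ-0 a≉0 p))) (sym (*-identityˡ _))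
    cancel : ∀ {x y} → x * y ≈ 1# → ∀ z → x * (y * z) ≈ z
    cancel xy≈1 z = trans (sym (*-assoc _ _ _)) (trans (*-congʳ xy≈1) (*-identityˡ z))
    U = P.sum (λ i → u (point i))
    U≉0 : ¬ (U ≈ 0#)
    U≉0 = prod-≉0 _ (λ i → u≉0 (point i))
    same : P.sum (replicate n a) * U ≈ P.sum (λ i → w (point i)) * U
    same = begin
      P.sum (replicate n a) * U
        ≈⟨ P.∑-distrib-+ (replicate n a) (λ i → u (point i)) ⟨
      P.sum (λ i → a * u (point i))                          ≈⟨ P.sum-cong-≋ (λ i → au (point i)) ⟩
      P.sum (λ i → w (point i) * u (a * point i))            ≈⟨ P.∑-distrib-+ (λ i → w (point i)) _ ⟩
      P.sum (λ i → w (point i)) * P.sum (λ i → u (a * point i))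
        ≈⟨ *-congˡ (sum-invariant *-commutativeMonoid u u-cong (a *_) (inv a *_) *-congˡ *-congˡ
             (cancel (inverseʳ a a≉0)) (cancel (trans (*-comm _ _) (inverseʳ a a≉0)))) ⟨
      P.sum (λ i → w (point i)) * U                          ∎
    cancelProd : P.sum (replicate n a) ≈ P.sum (λ i → w (point i))
    cancelProd = begin
      P.sum (replicate n a)                       ≈⟨ *-identityʳ _ ⟨
      P.sum (replicate n a) * 1#                  ≈⟨ *-congˡ (inverseʳ U U≉0) ⟨
      P.sum (replicate n a) * (U * inv U)         ≈⟨ *-assoc _ _ _ ⟨
      P.sum (replicate n a) * U * inv U           ≈⟨ *-congʳ same ⟩
      P.sum (λ i → w (point i)) * U * inv U       ≈⟨ *-assoc _ _ _ ⟩
      P.sum (λ i → w (point i)) * (U * inv U)     ≈⟨ *-congˡ (inverseʳ U U≉0) ⟩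
      P.sum (λ i → w (point i)) * 1#              ≈⟨ *-identityʳ _ ⟩
      P.sum (λ i → w (point i))                   ∎

-- Characteristic two

module Sums {c ℓ : Level} (F : CommutativeRing c ℓ) where
  open Ops F hiding (zero)

  CharacteristicTwo : Set ℓ
  CharacteristicTwo = 1# + 1# ≈ 0#

  sumTo-cong : ∀ n {g h : ℕ → Carrier} → (∀ i → i < n → g i ≈ h i) → sumTo n g ≈ sumTo n h
  sumTo-cong zero    g≈h = refl
  sumTo-cong (suc n) g≈h =
    +-cong (sumTo-cong n λ i i<n → g≈h i (ℕ.m<n⇒m<1+n i<n)) (g≈h n ℕ.≤-refl)

  sumTo-+ : ∀ m n (g : ℕ → Carrier) → sumTo (m +ℕ n) g ≈ sumTo m g + sumTo n (λ i → g (m +ℕ i))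
  sumTo-+ m zero    g rewrite ℕ.+-identityʳ m = sym (+-identityʳ _)
  sumTo-+ m (suc n) g rewrite ℕ.+-suc m n = trans (+-congʳ (sumTo-+ m n g)) (+-assoc _ _ _)

module Char2 {c ℓ : Level} (F : CommutativeRing c ℓ)
             (1+1≈0 : Sums.CharacteristicTwo F) where
  open Ops F hiding (zero)
  open Exp commutativeSemiring using (^-congˡ; ^-assocʳ)
  open SetoidReasoning setoid

  private
    fromBool : Bool → Carrier
    fromBool false = 0#
    fromBool true  = 1#

    +-homo : ∀ a b → fromBool (a xor b) ≈ fromBool a + fromBool b
    +-homo false b     = sym (+-identityˡ _)
    +-homo true  false = sym (+-identityʳ _)
    +-homo true  true  = sym 1+1≈0

    *-homo : ∀ a b → fromBool (a ∧ b) ≈ fromBool a * fromBool b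
    *-homo false b = sym (zeroˡ _)
    *-homo true  b = sym (*-identityˡ _)

    GF2 : RawRing _ _
    GF2 = record
      { Carrier = Bool ; _≈_ = _≡_ ; _+_ = _xor_ ; _*_ = _∧_ ; -_ = id ; 0# = false ; 1# = true }

    almostRing : AlmostCommutativeRing _ _
    almostRing = fromCommutativeSemiring commutativeSemiring

    homomorphism : GF2 -Raw-AlmostCommutative⟶ almostRing
    homomorphism = record
      { ⟦_⟧ = fromBool ; +-homo = +-homo ; *-homo = *-homo ; -‿homo = λ _ → refl
      ; 0-homo = refl ; 1-homo = refl }

    fromBool-≟ : ∀ a b → Maybe (fromBool a ≈ fromBool b)
    fromBool-≟ false false = just refl
    fromBool-≟ true  true  = just refl
    fromBool-≟ _     _     = nothing

  -- With coefficients in the field of two elements, normalisation cancels y + y, so the solver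
  -- decides identities modulo 2.
  module GF2Solver = Algebra.Solver.Ring GF2 almostRing homomorphism fromBool-≟
  open GF2Solver using (solve; _:+_; _:*_; _:^_; _:=_; con)

  1^n≈1 : ∀ n → 1# ^ n ≈ 1#
  1^n≈1 zero    = refl
  1^n≈1 (suc n) = trans (*-identityˡ _) (1^n≈1 n)

  x+y≈0⇒x≈y : ∀ {x y} → x + y ≈ 0# → x ≈ y
  x+y≈0⇒x≈y {x} {y} p =
    trans (solve 2 (λ x y → x := x :+ y :+ y) refl x y) (trans (+-congʳ p) (+-identityˡ y))

  -- Q stays general because the linearised polynomials are in powers of 4 in case (2) and of 2 in
  -- case (3).
  AdditivePower : ℕ → Set (c ⊔ ℓ)
  AdditivePower Q = ∀ x y → (x + y) ^ Q ≈ x ^ Q + y ^ Q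

  additivePower-* : ∀ P Q → AdditivePower P → AdditivePower Q → AdditivePower (P *ℕ Q)
  additivePower-* P Q addP addQ x y = begin
    (x + y) ^ (P *ℕ Q)              ≈⟨ ^-assocʳ (x + y) P Q ⟨
    ((x + y) ^ P) ^ Q               ≈⟨ ^-congˡ Q (addP x y) ⟩
    (x ^ P + y ^ P) ^ Q             ≈⟨ addQ (x ^ P) (y ^ P) ⟩
    (x ^ P) ^ Q + (y ^ P) ^ Q       ≈⟨ +-cong (^-assocʳ x P Q) (^-assocʳ y P Q) ⟩
    x ^ (P *ℕ Q) + y ^ (P *ℕ Q)     ∎

  additivePower-^ : ∀ Q → AdditivePower Q → ∀ k → AdditivePower (Q ^ℕ k)
  additivePower-^ Q addQ zero    x y = solve 2 (λ x y → (x :+ y) :^ 1 := x :^ 1 :+ y :^ 1) refl x y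
  additivePower-^ Q addQ (suc k) = additivePower-* Q (Q ^ℕ k) addQ (additivePower-^ Q addQ k)

  additivePower-2 : AdditivePower 2
  additivePower-2 = solve 2 (λ x y → (x :+ y) :^ 2 := x :^ 2 :+ y :^ 2) refl

  frobenius : ∀ k → AdditivePower (2 ^ℕ k)
  frobenius = additivePower-^ 2 additivePower-2

  -- h is a polynomial function of degree at most n whose coefficient of x ^ n is g: the factor
  -- theorem holds for h at every point a, with a quotient of the same kind.  In characteristic
  -- two, x + a is x − a.
  data LeadingCoeff : ℕ → Carrier → (Carrier → Carrier) → Set (c ⊔ ℓ) where
    constant  : ∀ {g h} → (∀ x → h x ≈ g) → LeadingCoeff zero g h
    divisible : ∀ {n g h} →
                (∀ a → Σ (Carrier → Carrier) λ h′ → LeadingCoeff n g h′ × (∀ x → h x ≈ h a + (x + a) * h′ x)) →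
                LeadingCoeff (suc n) g h

  leadingCoeff-cong : ∀ {n g g′ h h′} → LeadingCoeff n g h → g ≈ g′ → (∀ x → h x ≈ h′ x) → LeadingCoeff n g′ h′
  leadingCoeff-cong (constant h≈g)   g≈g′ h≈h′ = constant λ x → trans (sym (h≈h′ x)) (trans (h≈g x) g≈g′)
  leadingCoeff-cong (divisible quot) g≈g′ h≈h′ = divisible λ a → let k , lead , eq = quot a in
    k , leadingCoeff-cong lead g≈g′ (λ _ → refl) ,
    λ x → trans (sym (h≈h′ x)) (trans (eq x) (+-congʳ (h≈h′ a)))

  leadingCoeff-+ : ∀ {n g₁ g₂ h₁ h₂} → LeadingCoeff n g₁ h₁ → LeadingCoeff n g₂ h₂ →
                   LeadingCoeff n (g₁ + g₂) (λ x → h₁ x + h₂ x)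
  leadingCoeff-+ (constant eq₁)   (constant eq₂)   = constant λ x → +-cong (eq₁ x) (eq₂ x)
  leadingCoeff-+ (divisible quot₁) (divisible quot₂) = divisible λ a →
    let k₁ , lead₁ , eq₁ = quot₁ a
        k₂ , lead₂ , eq₂ = quot₂ a
    in _ , leadingCoeff-+ lead₁ lead₂ , λ x → trans (+-cong (eq₁ x) (eq₂ x))
         (solve 5 (λ u v y s t → (u :+ y :* s) :+ (v :+ y :* t) := (u :+ v) :+ y :* (s :+ t))
              refl _ _ (x + a) (k₁ x) (k₂ x))

  leadingCoeff-scale : ∀ {n g h} u → LeadingCoeff n g h → LeadingCoeff n (u * g) (λ x → u * h x)
  leadingCoeff-scale u (constant eq)    = constant λ x → *-congˡ (eq x)
  leadingCoeff-scale u (divisible quot) = divisible λ a → let k , lead , eq = quot a in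
    _ , leadingCoeff-scale u lead , λ x → trans (*-congˡ (eq x))
      (solve 4 (λ u v y s → u :* (v :+ y :* s) := u :* v :+ y :* (u :* s)) refl u _ (x + a) (k x))

  leadingCoeff-suc : ∀ {n g h} → LeadingCoeff n g h → LeadingCoeff (suc n) 0# h
  leadingCoeff-suc (constant eq) = divisible λ a → (λ _ → 0#) , constant (λ _ → refl) , λ x →
    trans (trans (eq x) (sym (eq a))) (solve 2 (λ y v → v := v :+ y :* con false) refl (x + a) _)
  leadingCoeff-suc (divisible quot) = divisible λ a → let k , lead , eq = quot a in
    k , leadingCoeff-suc lead , eq

  leadingCoeff-< : ∀ {m n g h} → LeadingCoeff m g h → m < n → LeadingCoeff n 0# h
  leadingCoeff-< {m} {n} {h = h} lead m<n =
    ≡.subst (λ n → LeadingCoeff n 0# h) (ℕ.m∸n+n≡m m<n) (raise (n ∸ℕ suc m))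
    where
    raise : ∀ d → LeadingCoeff (d +ℕ suc m) 0# h
    raise zero    = leadingCoeff-suc lead
    raise (suc d) = leadingCoeff-suc (raise d)

  -- If h = h(a) + (x + a) k, then x h = a h(a) + (x + a)(h + a k). The summand a k has lower degree
  -- than h, so the quotient keeps the leading coefficient of h.
  leadingCoeff-x* : ∀ {n g h} → LeadingCoeff n g h → LeadingCoeff (suc n) g (λ x → x * h x)
  leadingCoeff-x* {g = g} lead@(constant eq) = divisible λ a → (λ _ → g) , constant (λ _ → refl) , λ x →
    trans (*-congˡ (eq x)) (trans (solve 3 (λ x a g → x :* g := a :* g :+ (x :+ a) :* g) refl x a g)
      (+-congʳ (*-congˡ (sym (eq a)))))
  leadingCoeff-x* {h = h} lead@(divisible quot) = divisible λ a → let k , lead′ , eq = quot a in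
    (λ x → h x + a * k x) ,
    leadingCoeff-cong (leadingCoeff-+ lead (leadingCoeff-suc (leadingCoeff-scale a lead′)))
      (+-identityʳ _) (λ _ → refl) ,
    λ x → trans (*-congˡ (eq x)) (trans
      (solve 4 (λ x a v s → x :* (v :+ (x :+ a) :* s) := a :* v :+ (x :+ a) :* ((v :+ (x :+ a) :* s) :+ a :* s))
        refl x a (h a) (k x))
      (+-congˡ (*-congˡ (+-congʳ (sym (eq x))))))

  leadingCoeff-x^ : ∀ n → LeadingCoeff n 1# (_^ n)
  leadingCoeff-x^ zero    = constant λ _ → refl
  leadingCoeff-x^ (suc n) = leadingCoeff-x* (leadingCoeff-x^ n)

  leadingCoeff-0 : ∀ n → LeadingCoeff n 0# (λ _ → 0#)
  leadingCoeff-0 zero    = constant λ _ → refl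
  leadingCoeff-0 (suc n) = leadingCoeff-suc (leadingCoeff-0 n)

  -- All exponents in the sum are below e n; the coefficient 0 at e n leaves the place free for the
  -- next term.
  leadingCoeff-sumTo : ∀ {e : ℕ → ℕ} → (∀ i → e i < e (suc i)) → ∀ (u : ℕ → Carrier) n →
                       LeadingCoeff (e n) 0# (λ x → sumTo n (λ i → u i * x ^ e i))
  leadingCoeff-sumTo {e} e-mono u zero    = leadingCoeff-0 (e 0)
  leadingCoeff-sumTo {e} e-mono u (suc n) = leadingCoeff-<
    (leadingCoeff-+ (leadingCoeff-sumTo e-mono u n) (leadingCoeff-scale (u n) (leadingCoeff-x^ (e n))))
    (e-mono n)

-- Root counting and lacunary polynomials

module FiniteChar2 {c ℓ : Level} (F : CommutativeRing c ℓ) (isF : Ops.IsField F)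
                   (r : ℕ) (card : Ops.HasCard F (2 ^ℕ r)) where
  open Ops F hiding (zero)
  open FiniteField F isF (2 ^ℕ r) card public
  open Char2 F (2^k-card⇒1+1≈0 r ≡.refl) public
  open Sums F public
  open Exp commutativeSemiring using (^-congˡ; ^-congʳ; ^-assocʳ)
  open GF2Solver using (solve; _:+_; _:=_; con)
  open SetoidReasoning setoid

  -- Splitting off the root `p zero` leaves a quotient with the same leading coefficient, of which
  -- the other points are roots; n such steps reach a constant that is 0.
  leadingCoeff-vanishes : ∀ {n g h} → LeadingCoeff n g h → (p : Fin (suc n) → Carrier) →
                          (∀ {i j} → p i ≈ p j → i ≡ j) → (∀ i → h (p i) ≈ 0#) → g ≈ 0#
  leadingCoeff-vanishes (constant eq)    p p-inj root = trans (sym (eq (p zero))) (root zero)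
  leadingCoeff-vanishes (divisible quot) p p-inj root =
    let k , lead , eq = quot (p zero) in
    leadingCoeff-vanishes lead (λ i → p (suc i)) (λ q → Fin.suc-injective (p-inj q)) λ i →
      *-cancelˡ-0 (λ q → Fin.0≢1+n (≡.sym (p-inj (x+y≈0⇒x≈y q))))
        (trans (trans (sym (+-identityˡ _)) (+-congʳ (sym (root zero))))
          (trans (sym (eq (p (suc i)))) (root (suc i))))

  -- The top exponent is below the cardinality, so F has more points than the degree and the top
  -- coefficient is 0. Dropping that term allows induction.
  lacunary-vanishes : ∀ {e : ℕ → ℕ} → (∀ i → e i < e (suc i)) → ∀ (u : ℕ → Carrier) n → e n ≤ 2 ^ℕ r →
                      (∀ x → sumTo n (λ i → u i * x ^ e i) ≈ 0#) → ∀ i → i < n → u i ≈ 0#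
  lacunary-vanishes {e} e-mono u (suc n) e≤ vanish i i<1+n = case (ℕ.m<1+n⇒m<n∨m≡n i<1+n)
    where
    e[n]<card : e n < 2 ^ℕ r
    e[n]<card = ℕ.<-≤-trans (e-mono n) e≤
    un≈0 : u n ≈ 0#
    un≈0 = leadingCoeff-vanishes
      (leadingCoeff-cong
        (leadingCoeff-+ (leadingCoeff-sumTo e-mono u n) (leadingCoeff-scale (u n) (leadingCoeff-x^ (e n))))
        (trans (+-identityˡ _) (*-identityʳ _)) (λ _ → refl))
      (λ i → point (inject≤ i e[n]<card))
      (λ q → Fin.inject≤-injective e[n]<card e[n]<card _ _ (point-injective q))
      (λ i → vanish _)
    case : i < n ⊎ i ≡ n → u i ≈ 0#
    case (inj₂ ≡.refl) = un≈0
    case (inj₁ i<n)    = lacunary-vanishes e-mono u n (ℕ.<⇒≤ e[n]<card) (λ x → begin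
      sumTo n (λ i → u i * x ^ e i)                    ≈⟨ +-identityʳ _ ⟨
      sumTo n (λ i → u i * x ^ e i) + 0#               ≈⟨ +-congˡ (trans (*-congʳ un≈0) (zeroˡ _)) ⟨
      sumTo n (λ i → u i * x ^ e i) + u n * x ^ e n    ≈⟨ vanish x ⟩
      0#                                               ∎) i i<n

  -- Expanding Tr turns the sum into Σ_{i < 3k} u_{i mod k} x^(Q^i), whose exponents are distinct
  -- and below the cardinality of F.
  trace-lacunary-vanishes : ∀ Q k m → AdditivePower Q → 1 < Q → Q ^ℕ k ≡ 2 ^ℕ m → 3 *ℕ m ≤ r →
                            ∀ (u : ℕ → Carrier) →
                            (∀ x → sumTo k (λ i → u i * Tr m x ^ (Q ^ℕ i)) ≈ 0#) →
                            ∀ i → i < k → u i ≈ 0#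
  trace-lacunary-vanishes Q k@(suc k-1) m addQ 1<Q Q^k≡2^m 3m≤r u vanish i i<k = begin
    u i            ≡⟨ ≡.cong u (ℕ.m<n⇒m%n≡m i<k) ⟨
    u (i ℕ.% k)
      ≈⟨ lacunary-vanishes (λ i → ℕ.^-monoʳ-< Q 1<Q (ℕ.n<1+n i)) (λ i → u (i ℕ.% k)) (k +ℕ (k +ℕ k))
                        Q^3k≤2^r (λ x → trans (expand x) (vanish x)) i (ℕ.<-≤-trans i<k (ℕ.m≤m+n k _)) ⟩
    0#             ∎
    where
    Q^3k≤2^r : Q ^ℕ (k +ℕ (k +ℕ k)) ≤ 2 ^ℕ r
    Q^3k≤2^r = ℕ.≤-trans (ℕ.≤-reflexive (≡.trans (ℕ.^-distribˡ-+-* Q k (k +ℕ k)) (≡.trans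
      (≡.cong (Q ^ℕ k *ℕ_) (ℕ.^-distribˡ-+-* Q k k)) (≡.trans
      (≡.cong (λ a → a *ℕ (a *ℕ a)) Q^k≡2^m) (≡.trans
      (≡.cong (2 ^ℕ m *ℕ_) (≡.sym (ℕ.^-distribˡ-+-* 2 m m))) (≡.trans
      (≡.sym (ℕ.^-distribˡ-+-* 2 m (m +ℕ m))) (≡.cong (λ a → 2 ^ℕ (m +ℕ (m +ℕ a))) (≡.sym (ℕ.+-identityʳ m)))))))))
      (ℕ.^-monoʳ-≤ 2 3m≤r)
    shift : ∀ i → (k +ℕ i) ℕ.% k ≡ i ℕ.% k
    shift i = ≡.trans (≡.cong (ℕ._% k) (ℕ.+-comm k i)) (ℕ.[m+n]%n≡m%n i k)
    x^Q^[k+i] : ∀ x i → x ^ (Q ^ℕ (k +ℕ i)) ≈ (x ^ (2 ^ℕ m)) ^ (Q ^ℕ i)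
    x^Q^[k+i] x i = begin
      x ^ (Q ^ℕ (k +ℕ i))            ≡⟨ ≡.cong (x ^_) (ℕ.^-distribˡ-+-* Q k i) ⟩
      x ^ (Q ^ℕ k *ℕ Q ^ℕ i)         ≈⟨ ^-assocʳ x (Q ^ℕ k) (Q ^ℕ i) ⟨
      (x ^ (Q ^ℕ k)) ^ (Q ^ℕ i)      ≡⟨ ≡.cong (λ a → (x ^ a) ^ (Q ^ℕ i)) Q^k≡2^m ⟩
      (x ^ (2 ^ℕ m)) ^ (Q ^ℕ i)      ∎
    x^q^2 : ∀ x → (x ^ (2 ^ℕ m)) ^ (2 ^ℕ m) ≈ x ^ ((2 ^ℕ m) ^ℕ 2)
    x^q^2 x = trans (^-assocʳ x (2 ^ℕ m) (2 ^ℕ m))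
      (^-congʳ x (≡.cong (2 ^ℕ m *ℕ_) (≡.sym (ℕ.*-identityʳ (2 ^ℕ m)))))
    term : Carrier → ℕ → Carrier
    term x i = u (i ℕ.% k) * x ^ (Q ^ℕ i)
    term-shift : ∀ x i → term x (k +ℕ i) ≈ term (x ^ (2 ^ℕ m)) i
    term-shift x i = *-cong (reflexive (≡.cong u (shift i))) (x^Q^[k+i] x i)
    -- As Q^k = q, moving the index by k replaces x by its conjugate x^q. The three blocks of k
    -- terms belong to the three conjugates of x.
    expand : ∀ x → sumTo (k +ℕ (k +ℕ k)) (term x) ≈ sumTo k (λ i → u i * Tr m x ^ (Q ^ℕ i))
    expand x = begin
      sumTo (k +ℕ (k +ℕ k)) (term x)
        ≈⟨ sumTo-+ k (k +ℕ k) _ ⟩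
      sumTo k (term x) + sumTo (k +ℕ k) (λ i → term x (k +ℕ i))
        ≈⟨ +-congˡ (trans (sumTo-cong (k +ℕ k) λ i _ → term-shift x i) (sumTo-+ k k _)) ⟩
      sumTo k (term x) + (sumTo k (term y) + sumTo k (λ i → term y (k +ℕ i)))
        ≈⟨ +-congˡ (+-congˡ (sumTo-cong k λ i _ → term-shift y i)) ⟩
      sumTo k (term x) + (sumTo k (term y) + sumTo k (term z))
        ≈⟨ sumTo-add3 k ⟨
      sumTo k (λ i → term x i + (term y i + term z i))
        ≈⟨ sumTo-cong k collect ⟩
      sumTo k (λ i → u i * Tr m x ^ (Q ^ℕ i)) ∎
      where
      y = x ^ (2 ^ℕ m)
      z = y ^ (2 ^ℕ m)
      sumTo-add3 : ∀ n → sumTo n (λ i → term x i + (term y i + term z i)) ≈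
                         sumTo n (term x) + (sumTo n (term y) + sumTo n (term z))
      sumTo-add3 zero    = solve 0 (con false := con false :+ (con false :+ con false)) refl
      sumTo-add3 (suc n) = trans (+-congʳ (sumTo-add3 n))
        (solve 6 (λ a b c d e f → a :+ (b :+ c) :+ (d :+ (e :+ f)) := a :+ d :+ (b :+ e :+ (c :+ f))) refl
          (sumTo n (term x)) _ _ _ _ _)
      collect : ∀ i → i < k → term x i + (term y i + term z i) ≈ u i * Tr m x ^ (Q ^ℕ i)
      collect i i<k = begin
        term x i + (term y i + term z i)
          ≈⟨ trans (distribˡ _ _ _) (+-congˡ (distribˡ _ _ _)) ⟨
        u (i ℕ.% k) * (x ^ (Q ^ℕ i) + (y ^ (Q ^ℕ i) + z ^ (Q ^ℕ i)))
          ≈⟨ *-congʳ (reflexive (≡.cong u (ℕ.m<n⇒m%n≡m i<k))) ⟩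
        u i * (x ^ (Q ^ℕ i) + (y ^ (Q ^ℕ i) + z ^ (Q ^ℕ i)))
          ≈⟨ *-congˡ (trans (addQi x (y + z)) (+-congˡ (addQi y z))) ⟨
        u i * (x + (y + z)) ^ (Q ^ℕ i)
          ≈⟨ *-congˡ (^-congˡ (Q ^ℕ i) (trans (sym (+-assoc x y z)) (+-congˡ (x^q^2 x)))) ⟩
        u i * Tr m x ^ (Q ^ℕ i) ∎
        where addQi = additivePower-^ Q addQ i

-- The trace of f

module TraceReduction {c ℓ : Level} (F : CommutativeRing c ℓ) (isF : Ops.IsField F)
                      (m : ℕ) (card : Ops.HasCard F (2 ^ℕ (3 *ℕ m)))
                      (δ : CommutativeRing.Carrier F) where
  open Ops F hiding (zero)
  open FiniteChar2 F isF (3 *ℕ m) card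
  open Exp commutativeSemiring using (^-congˡ; ^-congʳ; ^-homo-*; ^-assocʳ; ^-distrib-*)
  open GF2Solver using (solve; _:+_; _:*_; _:^_; _:=_; con)
  open SetoidReasoning setoid

  q = 2 ^ℕ m
  A = Tr m (δ ^ (2 +ℕ q) + δ ^ (2 +ℕ q ^ℕ 2) + 1#)
  B = Tr m (δ ^ 2 + δ ^ (1 +ℕ q))
  D = δ ^ (q ^ℕ 2 +ℕ q +ℕ 1) * Tr m δ
  e = q ^ℕ 2 +ℕ q +ℕ 2
  f T : Carrier → Carrier
  f x = (Tr m x + δ) ^ e + x
  T x = Tr m x + D

  L : Carrier → Carrier
  L t = t ^ 4 + B * t ^ 2 + A * t

  φ : Carrier → Carrier
  φ x = x ^ q

  φ-cong : ∀ {x y} → x ≈ y → φ x ≈ φ y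
  φ-cong = ^-congˡ q

  -- The conjugates of the parts are arguments here and in the next two rules, so that the conjugate
  -- of a compound expression is assembled along its syntax, with `φφφ` closing the cycle.
  φ-+ : ∀ {x y x′ y′} → φ x ≈ x′ → φ y ≈ y′ → φ (x + y) ≈ x′ + y′
  φ-+ {x} {y} p r = trans (frobenius m x y) (+-cong p r)

  φ-* : ∀ {x y x′ y′} → φ x ≈ x′ → φ y ≈ y′ → φ (x * y) ≈ x′ * y′
  φ-* {x} {y} p r = trans (^-distrib-* x y q) (*-cong p r)

  φ-^ : ∀ {x x′} k → φ x ≈ x′ → φ (x ^ k) ≈ x′ ^ k
  φ-^ {x} k p = begin
    (x ^ k) ^ q     ≈⟨ ^-assocʳ x k q ⟩
    x ^ (k *ℕ q)    ≡⟨ ≡.cong (x ^_) (ℕ.*-comm k q) ⟩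
    x ^ (q *ℕ k)    ≈⟨ ^-assocʳ x q k ⟨
    (x ^ q) ^ k     ≈⟨ ^-congˡ k p ⟩
    _ ^ k           ∎

  φ-1 : φ 1# ≈ 1#
  φ-1 = 1^n≈1 q

  φφ : ∀ x → x ^ (q ^ℕ 2) ≈ φ (φ x)
  φφ x = trans (^-congʳ x (≡.cong (q *ℕ_) (ℕ.*-identityʳ q))) (sym (^-assocʳ x q q))

  φφφ : ∀ x → φ (φ (φ x)) ≈ x
  φφφ x = begin
    φ (φ (φ x))         ≈⟨ ^-assocʳ (φ x) q q ⟩
    φ x ^ (q *ℕ q)      ≈⟨ ^-assocʳ x q (q *ℕ q) ⟩
    x ^ (q *ℕ (q *ℕ q)) ≡⟨ ≡.cong (λ a → x ^ (q *ℕ (q *ℕ a))) (≡.sym (ℕ.*-identityʳ q)) ⟩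
    x ^ (q ^ℕ 3)        ≡⟨ ≡.cong (x ^_) (≡.trans (ℕ.^-*-assoc 2 m 3) (≡.cong (2 ^ℕ_) (ℕ.*-comm m 3))) ⟩
    x ^ (2 ^ℕ (3 *ℕ m)) ≈⟨ x^n≈x x ⟩
    x                   ∎

  Tr≈ : ∀ {x x′ x″} → φ x ≈ x′ → φ x′ ≈ x″ → Tr m x ≈ x + x′ + x″
  Tr≈ {x} p r = +-cong (+-congˡ p) (trans (φφ x) (trans (φ-cong p) r))

  Tr-cong : ∀ {x y} → x ≈ y → Tr m x ≈ Tr m y
  Tr-cong p = +-cong (+-cong p (φ-cong p)) (^-congˡ (q ^ℕ 2) p)

  Tr-+ : ∀ x y → Tr m (x + y) ≈ Tr m x + Tr m y
  Tr-+ x y = begin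
    Tr m (x + y)                                      ≈⟨ Tr≈ (φ-+ refl refl) (φ-+ refl refl) ⟩
    x + y + (φ x + φ y) + (φ (φ x) + φ (φ y))
      ≈⟨ solve 6 (λ a b c d e f → a :+ b :+ (c :+ d) :+ (e :+ f) := a :+ c :+ e :+ (b :+ d :+ f))
           refl x y (φ x) (φ y) _ _ ⟩
    x + φ x + φ (φ x) + (y + φ y + φ (φ y))           ≈⟨ +-cong (Tr≈ refl refl) (Tr≈ refl refl) ⟨
    Tr m x + Tr m y                                   ∎

  Tr∈Fq : ∀ x → InFq m (Tr m x)
  Tr∈Fq x = begin
    φ (Tr m x)                         ≈⟨ φ-cong (Tr≈ refl refl) ⟩
    φ (x + φ x + φ (φ x))              ≈⟨ φ-+ (φ-+ refl refl) (φφφ x) ⟩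
    φ x + φ (φ x) + x
      ≈⟨ solve 3 (λ a b c → b :+ c :+ a := a :+ b :+ c) refl x (φ x) (φ (φ x)) ⟩
    x + φ x + φ (φ x)                  ≈⟨ Tr≈ refl refl ⟨
    Tr m x                             ∎

  Tr-Fq : ∀ {t} → InFq m t → Tr m t ≈ t
  Tr-Fq {t} p = trans (Tr≈ p p) (solve 1 (λ t → t :+ t :+ t := t) refl t)

  A∈Fq : InFq m A
  A∈Fq = Tr∈Fq _

  B∈Fq : InFq m B
  B∈Fq = Tr∈Fq _

  private
    d₀ = δ
    d₁ = φ δ
    d₂ = φ (φ δ)

    -- For k = 1 this power is the norm of y to F_q; k = 2 is the exponent `e`.
    norm : ∀ y k → y ^ (q ^ℕ 2 +ℕ q +ℕ k) ≈ φ (φ y) * φ y * y ^ k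
    norm y k = trans (^-homo-* y (q ^ℕ 2 +ℕ q) k) (*-congʳ (trans (^-homo-* y (q ^ℕ 2) q) (*-congʳ (φφ y))))

    A≈ : A ≈ (d₀ ^ 2 * d₁ + d₀ ^ 2 * d₂ + 1#) + (d₁ ^ 2 * d₂ + d₁ ^ 2 * d₀ + 1#)
             + (d₂ ^ 2 * d₀ + d₂ ^ 2 * d₁ + 1#)
    A≈ = trans
      (Tr-cong (+-congʳ (+-cong (^-homo-* δ 2 q) (trans (^-homo-* δ 2 (q ^ℕ 2)) (*-congˡ (φφ δ))))))
      (Tr≈ (φ-+ (φ-+ (φ-* (φ-^ 2 refl) refl) (φ-* (φ-^ 2 refl) (φφφ δ))) φ-1)
           (φ-+ (φ-+ (φ-* (φ-^ 2 refl) (φφφ δ)) (φ-* (φ-^ 2 refl) refl)) φ-1))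

    B≈ : B ≈ (d₀ ^ 2 + d₀ * d₁) + (d₁ ^ 2 + d₁ * d₂) + (d₂ ^ 2 + d₂ * d₀)
    B≈ = Tr≈ (φ-+ (φ-^ 2 refl) (φ-* refl refl)) (φ-+ (φ-^ 2 refl) (φ-* refl (φφφ δ)))

    D≈ : D ≈ d₂ * d₁ * d₀ ^ 1 * (d₀ + d₁ + d₂)
    D≈ = *-cong (norm δ 1) (Tr≈ refl refl)

    Tr-power : ∀ {t} → InFq m t → Tr m ((t + δ) ^ e) ≈
      ((t + d₂) * (t + d₁) * (t + d₀) ^ 2) + ((t + d₀) * (t + d₂) * (t + d₁) ^ 2)
        + ((t + d₁) * (t + d₀) * (t + d₂) ^ 2)
    Tr-power {t} p = trans
      (Tr-cong (trans (norm (t + δ) 2) (*-congʳ (*-cong (trans (φ-cong p₀) p₁) p₀))))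
      (Tr≈ (φ-* (φ-* p₂ p₁) (φ-^ 2 p₀)) (φ-* (φ-* p₀ p₂) (φ-^ 2 p₁)))
      where
      p₀ : φ (t + d₀) ≈ t + d₁
      p₀ = φ-+ p refl
      p₁ : φ (t + d₁) ≈ t + d₂
      p₁ = φ-+ p refl
      p₂ : φ (t + d₂) ≈ t + d₀
      p₂ = φ-+ p (φφφ δ)

  D∈Fq : InFq m D
  D∈Fq = begin
    φ D                                       ≈⟨ φ-cong D≈ ⟩
    φ (d₂ * d₁ * d₀ ^ 1 * (d₀ + d₁ + d₂))
      ≈⟨ φ-* (φ-* (φ-* (φφφ δ) refl) (φ-^ 1 refl)) (φ-+ (φ-+ refl refl) (φφφ δ)) ⟩
    d₀ * d₂ * d₁ ^ 1 * (d₁ + d₂ + d₀)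
      ≈⟨ solve 3 (λ a b c → a :* c :* b :^ 1 :* (b :+ c :+ a) := c :* b :* a :^ 1 :* (a :+ b :+ c))
           refl d₀ d₁ d₂ ⟩
    d₂ * d₁ * d₀ ^ 1 * (d₀ + d₁ + d₂)         ≈⟨ D≈ ⟨
    D                                         ∎

  -- With e₁, e₂, e₃ the elementary symmetric functions of the conjugates of δ, both sides are
  -- (t³ + e₁t² + e₂t + e₃)(t + e₁) + t + e₁e₃.
  trace-of-f : ∀ x → T (f x) ≈ L (Tr m x)
  trace-of-f x = begin
    Tr m ((t + δ) ^ e + x) + D                ≈⟨ +-cong (trans (Tr-+ _ x) (+-congʳ (Tr-power (Tr∈Fq x)))) D≈ ⟩
    _                                         ≈⟨ solve 4 (λ t a b c →
        ((t :+ c) :* (t :+ b) :* (t :+ a) :^ 2 :+ (t :+ a) :* (t :+ c) :* (t :+ b) :^ 2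
            :+ (t :+ b) :* (t :+ a) :* (t :+ c) :^ 2)
          :+ t :+ c :* b :* a :^ 1 :* (a :+ b :+ c)
        := t :^ 4 :+ ((a :^ 2 :+ a :* b) :+ (b :^ 2 :+ b :* c) :+ (c :^ 2 :+ c :* a)) :* t :^ 2
          :+ ((a :^ 2 :* b :+ a :^ 2 :* c :+ con true) :+ (b :^ 2 :* c :+ b :^ 2 :* a :+ con true)
            :+ (c :^ 2 :* a :+ c :^ 2 :* b :+ con true)) :* t) refl t d₀ d₁ d₂ ⟩
    _                                         ≈⟨ +-cong (+-congˡ (*-congʳ B≈)) (*-congʳ A≈) ⟨
    L t                                       ∎
    where t = Tr m x

  L-surjective : Permutes f → ∀ {u} → InFq m u → Σ Carrier λ x → L (Tr m x) ≈ u
  L-surjective (_ , surj) {u} p = x , (begin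
    L (Tr m x)           ≈⟨ trace-of-f x ⟨
    Tr m (f x) + D       ≈⟨ +-congʳ (Tr-cong (fx≈ refl)) ⟩
    Tr m (u + D) + D     ≈⟨ +-congʳ (Tr-Fq (φ-+ p D∈Fq)) ⟩
    u + D + D            ≈⟨ solve 2 (λ u d → u :+ d :+ d := u) refl u D ⟩
    u                    ∎)
    where
    -- u + D is the element of F_q that T maps to u: `Tr` fixes F_q, and D + D = 0.
    x = proj₁ (surj (u + D))
    fx≈ = proj₂ (surj (u + D))

  -- Each `Tr m x` is itself a value of L on F_q by `L-surjective`. The conclusion is the hypothesis
  -- of `trace-lacunary-vanishes`.
  vanishes-on-trace : Permutes f → (G : Carrier → Carrier) → (∀ {x y} → x ≈ y → G x ≈ G y) →
                      (∀ x → G (L (Tr m x)) ≈ 0#) → ∀ x → G (Tr m x) ≈ 0#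
  vanishes-on-trace perm G G-cong GL≈0 x =
    let y , eq = L-surjective perm (Tr∈Fq x) in trans (G-cong (sym eq)) (GL≈0 y)

  inverse-criterion : Permutes f → (G : Carrier → Carrier) → (∀ {x y} → x ≈ y → G x ≈ G y) →
                      (∀ x → G (L (Tr m x)) ≈ Tr m x) →
                      IsCompInverse f (λ y → y + (δ + G (T y)) ^ e)
  inverse-criterion (_ , surj) G G-cong GL≈ = f∘g , g∘f
    where
    g : Carrier → Carrier
    g y = y + (δ + G (T y)) ^ e
    g-cong : ∀ {x y} → x ≈ y → g x ≈ g y
    g-cong p = +-cong p (^-congˡ e (+-congˡ (G-cong (+-congʳ (Tr-cong p)))))
    g∘f : ∀ x → g (f x) ≈ x
    g∘f x = begin
      f x + (δ + G (T (f x))) ^ e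
        ≈⟨ +-congˡ (^-congˡ e (trans (+-congˡ (trans (G-cong (trace-of-f x)) (GL≈ x))) (+-comm δ _))) ⟩
      (Tr m x + δ) ^ e + x + (Tr m x + δ) ^ e  ≈⟨ solve 2 (λ u x → u :+ x :+ u := x) refl _ x ⟩
      x                                        ∎
    -- Surjectivity turns the left inverse into a two-sided one: y is some f x, and g y is then x.
    f∘g : ∀ y → f (g y) ≈ y
    f∘g y = let x , fx≈ = surj y in fx≈ (trans (g-cong (sym (fx≈ refl))) (g∘f x))

-- The three inverses

-- (4 ^ n − 1) / 3
repunit₄ : ℕ → ℕ
repunit₄ zero    = 0
repunit₄ (suc n) = 4 ^ℕ n +ℕ repunit₄ n

4^n≡1+repunit₄*3 : ∀ n → 4 ^ℕ n ≡ 1 +ℕ repunit₄ n *ℕ 3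
4^n≡1+repunit₄*3 zero    = ≡.refl
4^n≡1+repunit₄*3 (suc n) = ≡.trans (rearrange (4 ^ℕ n))
  (≡.trans (≡.cong (4 ^ℕ n *ℕ 3 +ℕ_) (4^n≡1+repunit₄*3 n)) (rearrange′ (4 ^ℕ n) (repunit₄ n)))
  where
  rearrange : ∀ a → 4 *ℕ a ≡ a *ℕ 3 +ℕ a
  rearrange = solve-∀
  rearrange′ : ∀ a b → a *ℕ 3 +ℕ (1 +ℕ b *ℕ 3) ≡ 1 +ℕ (a +ℕ b) *ℕ 3
  rearrange′ = solve-∀

[4^n∸1]/3 : ∀ n → divBy (4 ^ℕ n ∸ℕ 1) 3 ≡ repunit₄ n
[4^n∸1]/3 n = ≡.trans (≡.cong (λ a → divBy (a ∸ℕ 1) 3) (4^n≡1+repunit₄*3 n)) (ℕ.m*n/n≡m (repunit₄ n) 3)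

4^k≡2^[k*2] : ∀ k → 4 ^ℕ k ≡ 2 ^ℕ (k *ℕ 2)
4^k≡2^[k*2] k = ≡.trans (ℕ.^-*-assoc 2 2 k) (≡.cong (2 ^ℕ_) (ℕ.*-comm 2 k))

gcd[k*2,2]≡2 : ∀ k → gcd (k *ℕ 2) 2 ≡ 2
gcd[k*2,2]≡2 k = ∣-antisym (gcd[m,n]∣n (k *ℕ 2) 2) (gcd-greatest (n∣m*n k) ∣-refl)

even-or-odd : ∀ m → (Σ ℕ λ k → m ≡ k *ℕ 2) ⊎ (Σ ℕ λ k → m ≡ 1 +ℕ k *ℕ 2)
even-or-odd m with m ℕ.divMod 2
... | ℕ.result k zero       eq = inj₁ (k , eq)
... | ℕ.result k (suc zero) eq = inj₂ (k , eq)

j+[1+k]≡n⇒n∸k≡1+j : ∀ j k {n} → j +ℕ suc k ≡ n → n ∸ℕ k ≡ suc j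
j+[1+k]≡n⇒n∸k≡1+j j k ≡.refl = ≡.trans (≡.cong (_∸ℕ k) (ℕ.+-suc j k)) (ℕ.m+n∸n≡m (suc j) k)

module Cases {c ℓ : Level} (F : CommutativeRing c ℓ) (isF : Ops.IsField F)
             (m : ℕ) (card : Ops.HasCard F (2 ^ℕ (3 *ℕ m)))
             (δ : CommutativeRing.Carrier F) where
  open Ops F hiding (zero)
  open Ops.IsField isF
  open FiniteChar2 F isF (3 *ℕ m) card
  open TraceReduction F isF m card δ
  open Exp commutativeSemiring using (^-congˡ; ^-congʳ; ^-assocʳ; ^-distrib-*)
  open GF2Solver using (solve; _:+_; _:*_; _:^_; _:=_; con)
  open SetoidReasoning setoid

  x^2≈x*x : ∀ x → x ^ 2 ≈ x * x
  x^2≈x*x x = *-congˡ (*-identityʳ x)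

  ^-swap : ∀ x j k → (x ^ j) ^ k ≈ (x ^ k) ^ j
  ^-swap x j k = trans (^-assocʳ x j k) (trans (^-congʳ x (ℕ.*-comm j k)) (sym (^-assocʳ x k j)))

  x^[Q^[1+k]] : ∀ x Q k → x ^ (Q ^ℕ suc k) ≈ (x ^ (Q ^ℕ k)) ^ Q
  x^[Q^[1+k]] x Q k = trans (sym (^-assocʳ x Q (Q ^ℕ k))) (^-swap x Q (Q ^ℕ k))

  -- The sum j + k avoids a subtraction of exponents. With k = 0 the left side is 1; otherwise this
  -- moves a term of a telescoping sum to the next denominator.
  ^-inverse : ∀ {a} → ¬ (a ≈ 0#) → ∀ j k → inv a ^ k ≈ inv a ^ (j +ℕ k) * a ^ j
  ^-inverse {a} a≉0 zero    k = sym (*-identityʳ _)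
  ^-inverse {a} a≉0 (suc j) k = trans (^-inverse a≉0 j k) (begin
    inv a ^ (j +ℕ k) * a ^ j                    ≈⟨ *-identityˡ _ ⟨
    1# * (inv a ^ (j +ℕ k) * a ^ j)             ≈⟨ *-congʳ (inverseʳ a a≉0) ⟨
    a * inv a * (inv a ^ (j +ℕ k) * a ^ j)
      ≈⟨ solve 4 (λ a b x y → a :* b :* (x :* y) := b :* x :* (a :* y)) refl a (inv a) _ _ ⟩
    inv a * inv a ^ (j +ℕ k) * (a * a ^ j)      ∎)

  inv≉0 : ∀ {a} → ¬ (a ≈ 0#) → ¬ (inv a ≈ 0#)
  inv≉0 {a} a≉0 p = 0≉1 (trans (sym (zeroʳ a)) (trans (*-congˡ (sym p)) (inverseʳ a a≉0)))

  case-A≈0-B≈0 : 1 ≤ m → Permutes f → A ≈ 0# → B ≈ 0# →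
                 IsCompInverse f (λ x → x + (T x ^ (2 ^ℕ (2 *ℕ m ∸ℕ 2)) + δ) ^ e)
  case-A≈0-B≈0 1≤m perm A≈0 B≈0 =
    let f∘g , g∘f = inverse-criterion perm (_^ E) (^-congˡ E) (λ x → G∘L (Tr∈Fq x)) in
    (λ x → trans (f-cong (+-congˡ (^-congˡ e (+-comm _ _)))) (f∘g x)) ,
    (λ x → trans (+-congˡ (^-congˡ e (+-comm _ _))) (g∘f x))
    where
    -- This is q²/4. On F_q it gives the same power as q/4 when m ≥ 2, because y^q = y there, and it
    -- is still an integer when m = 1.
    E = 2 ^ℕ (2 *ℕ m ∸ℕ 2)
    f-cong : ∀ {x y} → x ≈ y → f x ≈ f y
    f-cong p = +-cong (^-congˡ e (+-congʳ (Tr-cong p))) p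
    4*E : 4 *ℕ E ≡ q ^ℕ 2
    4*E = ≡.trans (≡.sym (ℕ.^-distribˡ-+-* 2 2 (2 *ℕ m ∸ℕ 2)))
      (≡.trans (≡.cong (2 ^ℕ_) (≡.trans (ℕ.m+[n∸m]≡n (ℕ.*-monoʳ-≤ 2 1≤m)) (ℕ.*-comm 2 m)))
        (≡.sym (ℕ.^-*-assoc 2 m 2)))
    G∘L : ∀ {t} → InFq m t → L t ^ E ≈ t
    G∘L {t} t∈Fq = begin
      L t ^ E                        ≈⟨ ^-congˡ E (+-cong (+-congˡ (*-congʳ B≈0)) (*-congʳ A≈0)) ⟩
      (t ^ 4 + 0# * t ^ 2 + 0# * t) ^ E
        ≈⟨ ^-congˡ E (solve 1 (λ t → t :^ 4 :+ con false :* t :^ 2 :+ con false :* t := t :^ 4) refl t) ⟩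
      (t ^ 4) ^ E                    ≈⟨ ^-assocʳ t 4 E ⟩
      t ^ (4 *ℕ E)                   ≈⟨ ^-congʳ t 4*E ⟩
      t ^ (q ^ℕ 2)                   ≈⟨ φφ t ⟩
      φ (φ t)                        ≈⟨ trans (φ-cong t∈Fq) t∈Fq ⟩
      t                              ∎

  -- The case B = 0: a linearised polynomial in powers of 4

  module B≈0 (perm : Permutes f) (B≈0 : B ≈ 0#) (A≉0 : ¬ (A ≈ 0#)) where
    α = inv A

    -- Dividing by A gives A^(4^k - 1) = A, and 3 divides 4^k - 1. The cube root is a power of A,
    -- hence in F_q.
    A^[4^k]≈A²⇒cube : ∀ k → A ^ (4 ^ℕ k) ≈ A * A → Σ Carrier λ y → InFq m y × y ^ 3 ≈ A
    A^[4^k]≈A²⇒cube k eq = y , trans (^-swap A (repunit₄ k) q) (^-congˡ (repunit₄ k) A∈Fq) , (begin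
      y ^ 3                    ≈⟨ *-identityˡ _ ⟨
      1# * y ^ 3               ≈⟨ *-congʳ (inverseʳ A A≉0) ⟨
      A * α * y ^ 3            ≈⟨ solve 3 (λ a b c → a :* b :* c := b :* (a :* c)) refl A α (y ^ 3) ⟩
      α * (A * y ^ 3)          ≈⟨ *-congˡ (*-congˡ (^-assocʳ A (repunit₄ k) 3)) ⟩
      α * A ^ (1 +ℕ repunit₄ k *ℕ 3)   ≡⟨ ≡.cong (λ n → α * A ^ n) (4^n≡1+repunit₄*3 k) ⟨
      α * A ^ (4 ^ℕ k)         ≈⟨ *-congˡ eq ⟩
      α * (A * A)              ≈⟨ *-assoc α A A ⟨
      α * A * A                ≈⟨ *-congʳ (trans (*-comm α A) (inverseʳ A A≉0)) ⟩
      1# * A                   ≈⟨ *-identityˡ A ⟩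
      A                        ∎)
      where y = A ^ repunit₄ k

    -- Here 4^(k + 1) = 2q, so this power of A is A². This excludes odd m when A is not a cube.
    odd⇒cube : ∀ k → m ≡ 1 +ℕ k *ℕ 2 → Σ Carrier λ y → InFq m y × y ^ 3 ≈ A
    odd⇒cube k m≡ = A^[4^k]≈A²⇒cube (suc k) (begin
      A ^ (4 ^ℕ suc k)
        ≡⟨ ≡.cong (A ^_) (≡.trans (4^k≡2^[k*2] (suc k)) (≡.cong (λ n → 2 ^ℕ suc n) (≡.sym m≡))) ⟩
      A ^ (2 ^ℕ suc m)         ≈⟨ x^[Q^[1+k]] A 2 m ⟩
      (A ^ q) ^ 2              ≈⟨ ^-congˡ 2 A∈Fq ⟩
      A ^ 2                    ≈⟨ x^2≈x*x A ⟩
      A * A                    ∎)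

    coeff : ℕ → Carrier
    coeff i = α ^ divBy (4 ^ℕ (i +ℕ 1) ∸ℕ 1) 3

    G₀ : ℕ → Carrier → Carrier
    G₀ k x = sumTo k (λ i → coeff i * x ^ (4 ^ℕ i))

    G₀-cong : ∀ k {x y} → x ≈ y → G₀ k x ≈ G₀ k y
    G₀-cong k p = sumTo-cong k λ i _ → *-congˡ (^-congˡ (4 ^ℕ i) p)

    coeff≈ : ∀ i → coeff i ≈ α ^ repunit₄ (suc i)
    coeff≈ i = ^-congʳ α (≡.trans (≡.cong (λ j → divBy (4 ^ℕ j ∸ℕ 1) 3) (ℕ.+-comm i 1)) ([4^n∸1]/3 (suc i)))

    L≈ : ∀ t → L t ≈ t ^ 4 + A * t
    L≈ t = +-congʳ (trans (+-congˡ (trans (*-congʳ B≈0) (zeroˡ _))) (+-identityʳ _))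

    -- With r = `repunit₄`, α^r(i + 1) A^(4^i) = α^r(i): the A-part of each term cancels the quartic
    -- part of the term before it, and only the two ends remain.
    G₀∘L : ∀ k t → G₀ k (L t) ≈ α ^ repunit₄ k * t ^ (4 ^ℕ k) + t
    G₀∘L zero    t = solve 1 (λ t → con false := con true :* t :^ 1 :+ t) refl t
    G₀∘L (suc k) t = begin
      G₀ k (L t) + coeff k * L t ^ (4 ^ℕ k)
        ≈⟨ +-cong (G₀∘L k t) (*-cong (coeff≈ k) (trans (^-congˡ (4 ^ℕ k) (L≈ t))
             (trans (additivePower-^ 4 additivePower-4 k (t ^ 4) (A * t))
               (+-cong (^-swap t 4 (4 ^ℕ k)) (^-distrib-* A t (4 ^ℕ k)))))) ⟩
      α ^ repunit₄ k * τ + t + β * (τ ^ 4 + a * τ)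
        ≈⟨ +-congʳ (+-congʳ (*-congʳ (^-inverse A≉0 (4 ^ℕ k) (repunit₄ k)))) ⟩
      β * a * τ + t + β * (τ ^ 4 + a * τ)
        ≈⟨ solve 4 (λ b a τ t → b :* a :* τ :+ t :+ b :* (τ :^ 4 :+ a :* τ) := b :* τ :^ 4 :+ t) refl β a τ t ⟩
      β * τ ^ 4 + t
        ≈⟨ +-congʳ (*-congˡ (x^[Q^[1+k]] t 4 k)) ⟨
      β * t ^ (4 ^ℕ suc k) + t ∎
      where
      τ = t ^ (4 ^ℕ k)
      a = A ^ (4 ^ℕ k)
      β = α ^ repunit₄ (suc k)
      additivePower-4 : AdditivePower 4
      additivePower-4 = frobenius 2

    module Even (k : ℕ) (m≡k*2 : m ≡ k *ℕ 2) (1≤k : 1 ≤ k) where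
      N ν : Carrier
      N = A ^ divBy (q ∸ℕ 1) 3
      ν = α ^ repunit₄ k

      4^k≡q : 4 ^ℕ k ≡ q
      4^k≡q = ≡.trans (4^k≡2^[k*2] k) (≡.cong (2 ^ℕ_) (≡.sym m≡k*2))

      Nν≈1 : N * ν ≈ 1#
      Nν≈1 = begin
        N * ν                          ≈⟨ *-comm N ν ⟩
        ν * N
          ≡⟨ ≡.cong (λ n → ν * A ^ n) (≡.trans (≡.cong (λ n → divBy (n ∸ℕ 1) 3) (≡.sym 4^k≡q)) ([4^n∸1]/3 k)) ⟩
        ν * A ^ repunit₄ k             ≡⟨ ≡.cong (λ n → α ^ n * A ^ repunit₄ k) (ℕ.+-identityʳ (repunit₄ k)) ⟨
        α ^ (repunit₄ k +ℕ 0) * A ^ repunit₄ k ≈⟨ ^-inverse A≉0 (repunit₄ k) 0 ⟨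
        1#                             ∎

      -- At 4^k = q the upper end is a multiple of t^q = t. As ν = 1/N, the constant is (1 + N)/N.
      G₀∘L-Fq : ∀ {t} → InFq m t → G₀ k (L t) ≈ (ν + 1#) * t
      G₀∘L-Fq {t} t∈Fq = begin
        G₀ k (L t)                     ≈⟨ G₀∘L k t ⟩
        ν * t ^ (4 ^ℕ k) + t           ≈⟨ +-congʳ (*-congˡ (trans (^-congʳ t 4^k≡q) t∈Fq)) ⟩
        ν * t + t                      ≈⟨ solve 2 (λ n t → n :* t :+ t := (n :+ con true) :* t) refl ν t ⟩
        (ν + 1#) * t                   ∎

      -- If N = 1 then G₀ ∘ L vanishes on F_q, hence so does G₀, whose coefficients are non-zero.
      1+N≉0 : ¬ (1# + N ≈ 0#)
      1+N≉0 1+N≈0 = ^≉0 (inv≉0 A≉0) 1 (trans (sym (coeff≈ 0))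
        (trace-lacunary-vanishes 4 k m (frobenius 2) (s≤s (s≤s z≤n)) 4^k≡q ℕ.≤-refl coeff
          (vanishes-on-trace perm (G₀ k) (G₀-cong k)
            (λ x → trans (G₀∘L-Fq (Tr∈Fq x)) (trans (*-congʳ ν+1≈0) (zeroˡ _)))) 0 1≤k))
        where
        ν+1≈0 : ν + 1# ≈ 0#
        ν+1≈0 = begin
          ν + 1#           ≈⟨ +-congˡ Nν≈1 ⟨
          ν + N * ν        ≈⟨ solve 2 (λ n v → v :+ n :* v := (con true :+ n) :* v) refl N ν ⟩
          (1# + N) * ν     ≈⟨ *-congʳ 1+N≈0 ⟩
          0# * ν           ≈⟨ zeroˡ ν ⟩
          0#               ∎

      compInverse : IsCompInverse f (λ x → x + (δ + (N * inv (1# + N)) * G₀ k (T x)) ^ e)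
      compInverse = inverse-criterion perm (λ u → N * inv (1# + N) * G₀ k u) (λ p → *-congˡ (G₀-cong k p)) λ x → begin
        N * inv (1# + N) * G₀ k (L (Tr m x))         ≈⟨ *-congˡ (G₀∘L-Fq (Tr∈Fq x)) ⟩
        N * inv (1# + N) * ((ν + 1#) * Tr m x)
          ≈⟨ solve 4 (λ n i v t → n :* i :* ((v :+ con true) :* t) := (n :* v :+ n) :* i :* t) refl N _ ν _ ⟩
        (N * ν + N) * inv (1# + N) * Tr m x
          ≈⟨ *-congʳ (trans (*-congʳ (+-congʳ Nν≈1)) (inverseʳ _ 1+N≉0)) ⟩
        1# * Tr m x                                  ≈⟨ *-identityˡ _ ⟩
        Tr m x                                       ∎

    compInverse : 1 ≤ m → ¬ (Σ Carrier λ y → InFq m y × y ^ 3 ≈ A) →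
                  let d = gcd m 2
                      N = A ^ divBy (2 ^ℕ m ∸ℕ 1) (2 ^ℕ d ∸ℕ 1)
                  in IsCompInverse f (λ x → x + (δ + (N * inv (1# + N)) * G₀ (divBy m d) (T x)) ^ e)
    compInverse 1≤m noncube with even-or-odd m
    ... | inj₂ (k , m≡) = contradiction (odd⇒cube k m≡) noncube
    ... | inj₁ (k , m≡) = ≡.subst₂
      (λ d j → let N = A ^ divBy (2 ^ℕ m ∸ℕ 1) (2 ^ℕ d ∸ℕ 1)
               in IsCompInverse f (λ x → x + (δ + (N * inv (1# + N)) * G₀ j (T x)) ^ e))
      (≡.sym gcd≡2) (≡.sym m/gcd≡k) (Even.compInverse k m≡ (k≥1 k m≡))
      where
      gcd≡2 : gcd m 2 ≡ 2
      gcd≡2 = ≡.trans (≡.cong (λ n → gcd n 2) m≡) (gcd[k*2,2]≡2 k)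
      m/gcd≡k : divBy m (gcd m 2) ≡ k
      m/gcd≡k = ≡.trans (≡.cong₂ divBy m≡ gcd≡2) (ℕ.m*n/n≡m k 2)
      k≥1 : ∀ k → m ≡ k *ℕ 2 → 1 ≤ k
      k≥1 zero    m≡0 = contradiction (≡.subst (1 ≤_) m≡0 1≤m) λ ()
      k≥1 (suc k) _   = s≤s z≤n

  -- The linearised polynomial with coefficients from the sequence S

  module A≉0 (perm : Permutes f) (A≉0 : ¬ (A ≈ 0#)) where
    α = inv A

    S : ℕ → Carrier
    S = Sshift A B

    x^[2^[1+k]] : ∀ x k → x ^ (2 ^ℕ suc k) ≈ x ^ (2 ^ℕ k) * x ^ (2 ^ℕ k)
    x^[2^[1+k]] x k = trans (x^[Q^[1+k]] x 2 k) (x^2≈x*x _)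

    -- S is a continuant: the recurrence can also be expanded from the other end.
    S-dual : ∀ n → S (2 +ℕ n) ≈ B * S (1 +ℕ n) ^ 2 + A ^ 2 * S n ^ 4
    S-dual zero = solve 2 (λ a b → b :^ 1 :* con true :+ a :^ 1 :* con false
      := b :* con true :^ 2 :+ a :^ 2 :* con false :^ 4) refl A B
    S-dual (suc zero) = solve 2 (λ a b → b :^ 2 :* (b :^ 1 :* con true :+ a :^ 1 :* con false) :+ a :^ 2 :* con true
      := b :* (b :^ 1 :* con true :+ a :^ 1 :* con false) :^ 2 :+ a :^ 2 :* con true :^ 4) refl A B
    S-dual (suc (suc n)) = begin
      B ^ (2 ^ℕ (2 +ℕ n)) * S (3 +ℕ n) + A ^ (2 ^ℕ (2 +ℕ n)) * S (2 +ℕ n)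
        ≈⟨ +-cong (*-cong (x^4 B) (S-dual (suc n))) (*-cong (x^4 A) (S-dual n)) ⟩
      b ^ 4 * (B * S (2 +ℕ n) ^ 2 + A ^ 2 * S (1 +ℕ n) ^ 4) + a ^ 4 * (B * S (1 +ℕ n) ^ 2 + A ^ 2 * S n ^ 4)
        ≈⟨ solve 7 (λ A B a b x y z →
             b :^ 4 :* (B :* x :^ 2 :+ A :^ 2 :* y :^ 4) :+ a :^ 4 :* (B :* y :^ 2 :+ A :^ 2 :* z :^ 4)
             := B :* (b :^ 2 :* x :+ a :^ 2 :* y) :^ 2 :+ A :^ 2 :* (b :* y :+ a :* z) :^ 4)
             refl A B a b (S (2 +ℕ n)) (S (1 +ℕ n)) (S n) ⟩
      B * (b ^ 2 * S (2 +ℕ n) + a ^ 2 * S (1 +ℕ n)) ^ 2 + A ^ 2 * S (2 +ℕ n) ^ 4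
        ≈⟨ +-congʳ (*-congˡ (^-congˡ 2 (+-cong (*-congʳ (x^[Q^[1+k]] B 2 n)) (*-congʳ (x^[Q^[1+k]] A 2 n))))) ⟨
      B * S (3 +ℕ n) ^ 2 + A ^ 2 * S (2 +ℕ n) ^ 4 ∎
      where
      a = A ^ (2 ^ℕ n)
      b = B ^ (2 ^ℕ n)
      x^4 : ∀ x → x ^ (2 ^ℕ (2 +ℕ n)) ≈ (x ^ (2 ^ℕ n)) ^ 4
      x^4 x = trans (x^[Q^[1+k]] x 2 (suc n)) (trans (^-congˡ 2 (x^[Q^[1+k]] x 2 n)) (^-assocʳ _ 2 2))

    L^[2^k] : ∀ t k → L t ^ (2 ^ℕ k) ≈
              (t ^ (2 ^ℕ k)) ^ 4 + B ^ (2 ^ℕ k) * (t ^ (2 ^ℕ k)) ^ 2 + A ^ (2 ^ℕ k) * t ^ (2 ^ℕ k)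
    L^[2^k] t k = trans (frobenius k _ _) (+-cong
      (trans (frobenius k _ _) (+-cong (^-swap t 4 Q) (trans (^-distrib-* B (t ^ 2) Q) (*-congˡ (^-swap t 2 Q)))))
      (^-distrib-* A t Q))
      where Q = 2 ^ℕ k

    -- The two summands of a coefficient of G telescope against L separately: `upper` by the
    -- defining recurrence of S, `lower` by `S-dual`.
    lower : ℕ → ℕ → Carrier
    lower m′ i = S (m′ ∸ℕ i) ^ (2 ^ℕ (i +ℕ 1))

    upper : ℕ → Carrier
    upper i = α ^ (2 ^ℕ (i +ℕ 1) ∸ℕ 1) * S (i +ℕ 1)

    -- Once the remainder is rewritten over the next power of α, the new term cancels its part in
    -- t^(2^k), and the two parts in t^(2^(k + 1)) combine to the next S by the recurrence.
    upper-sum : ∀ t k → sumTo k (λ i → upper i * L t ^ (2 ^ℕ i)) ≈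
                t + α ^ (2 ^ℕ k ∸ℕ 1) * (S (1 +ℕ k) * t ^ (2 ^ℕ k) + S k * t ^ (2 ^ℕ (1 +ℕ k)))
    upper-sum t zero = solve 1 (λ t → con false := t :+ con true :* (con true :* t :^ 1 :+ con false :* t :^ 2))
         refl t
    upper-sum t (suc k) rewrite ℕ.+-comm k 1 = begin
      sumTo k (λ i → upper i * L t ^ (2 ^ℕ i)) + β * S (1 +ℕ k) * L t ^ (2 ^ℕ k)
        ≈⟨ +-cong (trans (upper-sum t k) (+-congˡ (*-cong α-step (+-congˡ (*-congˡ (x^[Q^[1+k]] t 2 k))))))
             (*-congˡ (L^[2^k] t k)) ⟩
      t + β * a * (S (1 +ℕ k) * τ + S k * τ ^ 2) + β * S (1 +ℕ k) * (τ ^ 4 + b * τ ^ 2 + a * τ)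
        ≈⟨ solve 7 (λ t β a b x y τ →
             t :+ β :* a :* (x :* τ :+ y :* τ :^ 2) :+ β :* x :* (τ :^ 4 :+ b :* τ :^ 2 :+ a :* τ)
             := t :+ β :* ((b :* x :+ a :* y) :* τ :^ 2 :+ x :* (τ :^ 2) :^ 2))
             refl t β a b (S (1 +ℕ k)) (S k) τ ⟩
      t + β * (S (2 +ℕ k) * τ ^ 2 + S (1 +ℕ k) * (τ ^ 2) ^ 2)
        ≈⟨ +-congˡ (*-congˡ (+-cong (*-congˡ (x^[Q^[1+k]] t 2 k))
             (*-congˡ (trans (x^[Q^[1+k]] t 2 (suc k)) (^-congˡ 2 (x^[Q^[1+k]] t 2 k)))))) ⟨
      t + β * (S (2 +ℕ k) * t ^ (2 ^ℕ (1 +ℕ k)) + S (1 +ℕ k) * t ^ (2 ^ℕ (2 +ℕ k))) ∎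
      where
      τ = t ^ (2 ^ℕ k)
      a = A ^ (2 ^ℕ k)
      b = B ^ (2 ^ℕ k)
      β = α ^ (2 ^ℕ (1 +ℕ k) ∸ℕ 1)
      2^[1+k]∸1 : 2 ^ℕ k +ℕ (2 ^ℕ k ∸ℕ 1) ≡ 2 ^ℕ (1 +ℕ k) ∸ℕ 1
      2^[1+k]∸1 = ≡.trans (≡.sym (ℕ.+-∸-assoc (2 ^ℕ k) (ℕ.m^n>0 2 k)))
        (≡.cong (λ n → 2 ^ℕ k +ℕ n ∸ℕ 1) (≡.sym (ℕ.+-identityʳ (2 ^ℕ k))))
      α-step : α ^ (2 ^ℕ k ∸ℕ 1) ≈ β * a
      α-step = trans (^-inverse A≉0 (2 ^ℕ k) (2 ^ℕ k ∸ℕ 1)) (*-congʳ (^-congʳ α 2^[1+k]∸1))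

    -- `S-dual` raised to the power 2^k splits the remainder so that its B-part cancels that of the
    -- new term. `j` stands for m′ - k and goes down as k goes up.
    lower-sum : ∀ m′ t k j → j +ℕ k ≡ m′ → sumTo k (λ i → lower m′ i * L t ^ (2 ^ℕ i)) ≈
                A * S m′ ^ 2 * t + S (1 +ℕ m′) * t ^ 2
                  + (A ^ (2 ^ℕ k) * S j ^ (2 ^ℕ (1 +ℕ k)) * t ^ (2 ^ℕ k)
                    + S (1 +ℕ j) ^ (2 ^ℕ k) * t ^ (2 ^ℕ (1 +ℕ k)))
    lower-sum m′ t zero j j+0≡m′ rewrite ≡.trans (≡.sym (ℕ.+-identityʳ j)) j+0≡m′ =
      solve 4 (λ a x y t →
          con false := a :* x :^ 2 :* t :+ y :* t :^ 2 :+ (a :^ 1 :* x :^ 2 :* t :^ 1 :+ y :^ 1 :* t :^ 2))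
        refl A (S m′) (S (1 +ℕ m′)) t
    lower-sum m′ t (suc k) j j+1+k≡m′ rewrite ℕ.+-comm k 1 | j+[1+k]≡n⇒n∸k≡1+j j k j+1+k≡m′ = begin
      sumTo k (λ i → lower m′ i * L t ^ (2 ^ℕ i)) + σ * L t ^ (2 ^ℕ k)
        ≈⟨ +-cong (trans (lower-sum m′ t k (suc j) (≡.trans (≡.sym (ℕ.+-suc j k)) j+1+k≡m′))
             (+-congˡ (+-congˡ (*-cong S-step (x^[Q^[1+k]] t 2 k))))) (*-congˡ (L^[2^k] t k)) ⟩
      C + (a * σ * τ + (b * σ + a ^ 2 * ω) * τ ^ 2) + σ * (τ ^ 4 + b * τ ^ 2 + a * τ)
        ≈⟨ solve 6 (λ C a b σ ω τ →
             C :+ (a :* σ :* τ :+ (b :* σ :+ a :^ 2 :* ω) :* τ :^ 2) :+ σ :* (τ :^ 4 :+ b :* τ :^ 2 :+ a :* τ)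
             := C :+ (a :^ 2 :* ω :* τ :^ 2 :+ σ :* (τ :^ 2) :^ 2)) refl C a b σ ω τ ⟩
      C + (a ^ 2 * ω * τ ^ 2 + σ * (τ ^ 2) ^ 2)
        ≈⟨ +-congˡ (+-cong (*-cong (*-congʳ (x^[Q^[1+k]] A 2 k)) (x^[Q^[1+k]] t 2 k))
             (*-congˡ (trans (x^[Q^[1+k]] t 2 (suc k)) (^-congˡ 2 (x^[Q^[1+k]] t 2 k))))) ⟨
      C + (A ^ (2 ^ℕ (1 +ℕ k)) * ω * t ^ (2 ^ℕ (1 +ℕ k)) + σ * t ^ (2 ^ℕ (2 +ℕ k))) ∎
      where
      C = A * S m′ ^ 2 * t + S (1 +ℕ m′) * t ^ 2
      τ = t ^ (2 ^ℕ k)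
      a = A ^ (2 ^ℕ k)
      b = B ^ (2 ^ℕ k)
      σ = S (1 +ℕ j) ^ (2 ^ℕ (1 +ℕ k))
      ω = S j ^ (2 ^ℕ (2 +ℕ k))
      S-step : S (2 +ℕ j) ^ (2 ^ℕ k) ≈ b * σ + a ^ 2 * ω
      S-step = begin
        S (2 +ℕ j) ^ (2 ^ℕ k)
          ≈⟨ trans (^-congˡ (2 ^ℕ k) (S-dual j)) (frobenius k _ _) ⟩
        (B * S (1 +ℕ j) ^ 2) ^ (2 ^ℕ k) + (A ^ 2 * S j ^ 4) ^ (2 ^ℕ k)
          ≈⟨ +-cong (trans (^-distrib-* B _ (2 ^ℕ k))
                      (*-congˡ (trans (^-swap _ 2 (2 ^ℕ k)) (sym (x^[Q^[1+k]] _ 2 k)))))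
                    (trans (^-distrib-* (A ^ 2) _ (2 ^ℕ k)) (*-cong (^-swap A 2 (2 ^ℕ k))
                      (trans (^-assocʳ (S j) 4 (2 ^ℕ k)) (^-congʳ (S j) (ℕ.*-assoc 2 2 (2 ^ℕ k)))))) ⟩
        b * σ + a ^ 2 * ω ∎

    0^[2^k] : ∀ k → 0# ^ (2 ^ℕ k) ≈ 0#
    0^[2^k] zero    = *-identityʳ 0#
    0^[2^k] (suc k) = trans (x^[2^[1+k]] 0# k) (trans (*-congʳ (0^[2^k] k)) (zeroˡ _))

    module _ (m′ : ℕ) (m≡1+m′ : m ≡ suc m′) where
      t^[2^[1+m′]] : ∀ {t} → InFq m t → t ^ (2 ^ℕ suc m′) ≈ t
      t^[2^[1+m′]] {t} t∈Fq = trans (^-congʳ t (≡.cong (2 ^ℕ_) (≡.sym m≡1+m′))) t∈Fq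

      α^[q∸1]≈1 : α ^ (2 ^ℕ suc m′ ∸ℕ 1) ≈ 1#
      α^[q∸1]≈1 = *-cancelˡ-1 A≉0 (begin
        α ^ k * A                      ≈⟨ *-congˡ (t^[2^[1+m′]] A∈Fq) ⟨
        α ^ k * A ^ (2 ^ℕ suc m′)
          ≡⟨ ≡.cong (λ n → α ^ k * A ^ n) (≡.sym (ℕ.m+[n∸m]≡n (ℕ.m^n>0 2 (suc m′)))) ⟩
        α ^ k * (A * A ^ k)
          ≈⟨ solve 3 (λ x a y → x :* (a :* y) := x :* y :* a) refl (α ^ k) A (A ^ k) ⟩
        α ^ k * A ^ k * A              ≡⟨ ≡.cong (λ n → α ^ n * A ^ k * A) (ℕ.+-identityʳ k) ⟨
        α ^ (k +ℕ 0) * A ^ k * A       ≈⟨ *-congʳ (^-inverse A≉0 k 0) ⟨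
        1# * A                         ≈⟨ *-identityˡ A ⟩
        A                              ∎)
        where k = 2 ^ℕ suc m′ ∸ℕ 1

      coeff : ℕ → Carrier
      coeff i = lower m′ i + upper i

      G : ℕ → Carrier → Carrier
      G n u = sumTo n (λ i → coeff i * u ^ (2 ^ℕ i))

      -- The constant λ of this case, S_m + A S_{m-2}² in the unshifted indices.
      Z : Carrier
      Z = S (2 +ℕ m′) + A * S m′ ^ 2

      upper∘L : ∀ {t} → InFq m t → sumTo (suc m′) (λ i → upper i * L t ^ (2 ^ℕ i)) ≈
                t + (S (2 +ℕ m′) * t + S (1 +ℕ m′) * t ^ 2)
      upper∘L {t} t∈Fq = trans (upper-sum t (suc m′)) (+-congˡ (trans (*-cong α^[q∸1]≈1
        (+-cong (*-congˡ tq) (*-congˡ (trans (x^[Q^[1+k]] t 2 (suc m′)) (^-congˡ 2 tq))))) (*-identityˡ _)))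
        where tq = t^[2^[1+m′]] t∈Fq

      lower∘L : ∀ {t} → InFq m t → sumTo (suc m′) (λ i → lower m′ i * L t ^ (2 ^ℕ i)) ≈
                A * S m′ ^ 2 * t + S (1 +ℕ m′) * t ^ 2 + t
      lower∘L {t} t∈Fq = begin
        -- The last coefficient is a power of `S 0`, which is 0, so `lower-sum` is needed only up to
        -- k = m′, where j = 0.
        sumTo m′ (λ i → lower m′ i * L t ^ (2 ^ℕ i)) + lower m′ m′ * L t ^ (2 ^ℕ m′)
          ≈⟨ +-cong (lower-sum m′ t m′ 0 ≡.refl) (*-congʳ lower≈0) ⟩
        C + (A ^ (2 ^ℕ m′) * 0# ^ (2 ^ℕ suc m′) * t ^ (2 ^ℕ m′) + 1# ^ (2 ^ℕ m′) * t ^ (2 ^ℕ suc m′))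
          + 0# * L t ^ (2 ^ℕ m′)
          ≈⟨ +-congʳ (+-congˡ (+-cong (*-congʳ (*-congˡ (0^[2^k] (suc m′))))
               (*-cong (1^n≈1 (2 ^ℕ m′)) (t^[2^[1+m′]] t∈Fq)))) ⟩
        C + (A ^ (2 ^ℕ m′) * 0# * t ^ (2 ^ℕ m′) + 1# * t) + 0# * L t ^ (2 ^ℕ m′)
          ≈⟨ solve 5 (λ c a b t d → c :+ (a :* con false :* b :+ con true :* t) :+ con false :* d := c :+ t)
               refl C _ _ t _ ⟩
        C + t ∎
        where
        C = A * S m′ ^ 2 * t + S (1 +ℕ m′) * t ^ 2
        lower≈0 : lower m′ m′ ≈ 0#
        lower≈0 rewrite ℕ.n∸n≡0 m′ | ℕ.+-comm m′ 1 = 0^[2^k] (suc m′)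

      G∘L : ∀ {t} → InFq m t → G (suc m′) (L t) ≈ Z * t
      G∘L {t} t∈Fq = begin
        G (suc m′) (L t)
          ≈⟨ split (suc m′) ⟩
        sumTo (suc m′) (λ i → lower m′ i * L t ^ (2 ^ℕ i)) + sumTo (suc m′) (λ i → upper i * L t ^ (2 ^ℕ i))
          ≈⟨ +-cong (lower∘L t∈Fq) (upper∘L t∈Fq) ⟩
        -- Both halves leave t and the same multiple of t²; these cancel.
        A * S m′ ^ 2 * t + S (1 +ℕ m′) * t ^ 2 + t + (t + (S (2 +ℕ m′) * t + S (1 +ℕ m′) * t ^ 2))
          ≈⟨ solve 5 (λ a x y z t →
               a :* x :^ 2 :* t :+ y :* t :^ 2 :+ t :+ (t :+ (z :* t :+ y :* t :^ 2))
               := (z :+ a :* x :^ 2) :* t)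
               refl A (S m′) (S (1 +ℕ m′)) (S (2 +ℕ m′)) t ⟩
        Z * t ∎
        where
        split : ∀ n → G n (L t) ≈
                sumTo n (λ i → lower m′ i * L t ^ (2 ^ℕ i)) + sumTo n (λ i → upper i * L t ^ (2 ^ℕ i))
        split zero    = sym (+-identityʳ 0#)
        split (suc n) = trans (+-congʳ (split n))
          (solve 5 (λ x y a b l → x :+ y :+ (a :+ b) :* l := x :+ a :* l :+ (y :+ b :* l))
          refl _ _ (lower m′ n) (upper n) (L t ^ (2 ^ℕ n)))

      -- Since A and B lie in F_q, squaring the recurrence gives S_m² = B S_{m-1}² + A S_{m-2}².
      -- `S-dual` gives S_m = B S_{m-1}² + A² S_{m-2}⁴, and Z² regroups to Z.
      Z²≈Z : Z ^ 2 ≈ Z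
      Z²≈Z = begin
        Z ^ 2
          ≈⟨ solve 3 (λ a x z → (z :+ a :* x :^ 2) :^ 2 := z :^ 2 :+ a :^ 2 :* x :^ 4)
               refl A (S m′) (S (2 +ℕ m′)) ⟩
        S (2 +ℕ m′) ^ 2 + A ^ 2 * S m′ ^ 4
          ≈⟨ +-congʳ (begin
            (b * S (1 +ℕ m′) + a * S m′) ^ 2
              ≈⟨ solve 4 (λ a b x y → (b :* y :+ a :* x) :^ 2 := b :^ 2 :* y :^ 2 :+ a :^ 2 :* x :^ 2)
                                                              refl a b (S m′) (S (1 +ℕ m′)) ⟩
            b ^ 2 * S (1 +ℕ m′) ^ 2 + a ^ 2 * S m′ ^ 2
              ≈⟨ +-cong (*-congʳ (square B∈Fq)) (*-congʳ (square A∈Fq)) ⟩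
            B * S (1 +ℕ m′) ^ 2 + A * S m′ ^ 2          ∎) ⟩
        B * S (1 +ℕ m′) ^ 2 + A * S m′ ^ 2 + A ^ 2 * S m′ ^ 4
          ≈⟨ solve 3 (λ u v w → u :+ v :+ w := u :+ w :+ v) refl _ _ _ ⟩
        B * S (1 +ℕ m′) ^ 2 + A ^ 2 * S m′ ^ 4 + A * S m′ ^ 2
          ≈⟨ +-congʳ (S-dual m′) ⟨
        Z ∎
        where
        a = A ^ (2 ^ℕ m′)
        b = B ^ (2 ^ℕ m′)
        square : ∀ {x} → InFq m x → (x ^ (2 ^ℕ m′)) ^ 2 ≈ x
        square {x} x∈Fq = trans (sym (x^[Q^[1+k]] x 2 m′)) (t^[2^[1+m′]] x∈Fq)

      -- The coefficients are arbitrary because `Z≉0` uses this for `coeff` and then for `upper`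
      -- alone.
      vanishing : ∀ (u : ℕ → Carrier) → (∀ {t} → InFq m t → sumTo (suc m′) (λ i → u i * L t ^ (2 ^ℕ i)) ≈ 0#) →
                  ∀ i → i < suc m′ → u i ≈ 0#
      vanishing u vanish = trace-lacunary-vanishes 2 (suc m′) m additivePower-2 (s≤s (s≤s z≤n))
        (≡.cong (2 ^ℕ_) (≡.sym m≡1+m′)) ℕ.≤-refl u
        (vanishes-on-trace perm (λ x → sumTo (suc m′) (λ i → u i * x ^ (2 ^ℕ i)))
          (λ p → sumTo-cong (suc m′) λ i _ → *-congˡ (^-congˡ (2 ^ℕ i) p)) (λ x → vanish (Tr∈Fq x)))

      -- S (suc n) is the paper's S_n.  If Z = 0 then G vanishes on F_q, so its coefficients are 0;
      -- the outermost two give S_{m-1} = 0 and A S_{m-2}² = 1, whence S_m = 1.  But then the upper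
      -- part of G alone vanishes on F_q, although its coefficient at 0 is A⁻¹.
      Z≉0 : ¬ (Z ≈ 0#)
      Z≉0 Z≈0 = inv≉0 A≉0 (begin
        α                  ≈⟨ solve 1 (λ a → a := a :^ 1 :* con true) refl α ⟩
        upper 0            ≈⟨ vanishing upper (λ {t} t∈Fq → trans (upper∘L t∈Fq) (begin
          t + (S (2 +ℕ m′) * t + S (1 +ℕ m′) * t ^ 2)
            ≈⟨ +-congˡ (+-cong (*-congʳ S[2+m′]≈1) (*-congʳ S[1+m′]≈0)) ⟩
          t + (1# * t + 0# * t ^ 2)
            ≈⟨ solve 1 (λ t → t :+ (con true :* t :+ con false :* t :^ 2) := con false) refl t ⟩
          0#                                            ∎)) 0 (s≤s z≤n) ⟩
        0#                 ∎)
        where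
        coeff≈0 : ∀ i → i < suc m′ → coeff i ≈ 0#
        coeff≈0 = vanishing coeff (λ t∈Fq → trans (G∘L t∈Fq) (trans (*-congʳ Z≈0) (zeroˡ _)))
        coeff[m′] : coeff m′ ≈ S (1 +ℕ m′)
        coeff[m′] rewrite ℕ.n∸n≡0 m′ | ℕ.+-comm m′ 1 =
          trans (+-cong (0^[2^k] (suc m′)) (trans (*-congʳ α^[q∸1]≈1) (*-identityˡ _))) (+-identityˡ _)
        S[1+m′]≈0 : S (1 +ℕ m′) ≈ 0#
        S[1+m′]≈0 = trans (sym coeff[m′]) (coeff≈0 m′ ℕ.≤-refl)
        AS²≈1 : A * S m′ ^ 2 ≈ 1#
        AS²≈1 = x+y≈0⇒x≈y (begin
          -- This is A times `coeff 0`, whose two summands are the square of `S m′` and α.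
          A * S m′ ^ 2 + 1#                        ≈⟨ +-congˡ (inverseʳ A A≉0) ⟨
          A * S m′ ^ 2 + A * α
            ≈⟨ solve 3 (λ a b x → a :* x :^ 2 :+ a :* b := a :* (x :^ 2 :+ b :^ 1 :* con true))
                 refl A α (S m′) ⟩
          A * coeff 0                              ≈⟨ *-congˡ (coeff≈0 0 (s≤s z≤n)) ⟩
          A * 0#                                   ≈⟨ zeroʳ A ⟩
          0#                                       ∎)
        S[2+m′]≈1 : S (2 +ℕ m′) ≈ 1#
        S[2+m′]≈1 = trans (x+y≈0⇒x≈y Z≈0) AS²≈1

      Z≈1 : Z ≈ 1#
      Z≈1 = *-cancelˡ-1 Z≉0 (trans (sym (x^2≈x*x Z)) Z²≈Z)

      compInverse-suc : IsCompInverse f (λ x → x + (δ + G (suc m′) (T x)) ^ e)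
      compInverse-suc = inverse-criterion perm (G (suc m′))
        (λ p → sumTo-cong (suc m′) λ i _ → *-congˡ (^-congˡ (2 ^ℕ i) p))
        (λ x → trans (G∘L (Tr∈Fq x)) (trans (*-congʳ Z≈1) (*-identityˡ _)))

    compInverse : 1 ≤ m → IsCompInverse f (λ x → x + (δ +
      sumTo m (λ i → (lower (m ∸ℕ 1) i + upper i) * T x ^ (2 ^ℕ i))) ^ e)
    compInverse 1≤m = ≡.subst
      (λ n → IsCompInverse f (λ x → x +
        (δ + sumTo n (λ i → (lower (m ∸ℕ 1) i + upper i) * T x ^ (2 ^ℕ i))) ^ e))
      (ℕ.m+[n∸m]≡n 1≤m) (compInverse-suc (m ∸ℕ 1) (≡.sym (ℕ.m+[n∸m]≡n 1≤m)))

theorem4 : ∀ {c ℓ : Level} (F : CommutativeRing c ℓ) (isF : Ops.IsField F)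
      (m : ℕ) → 1 ≤ m → Ops.HasCard F (2 ^ℕ (3 *ℕ m)) →
      (δ : CommutativeRing.Carrier F) →
      let open Ops F
          open IsField isF
          q = 2 ^ℕ m
          A = Tr m (δ ^ (2 +ℕ q) + δ ^ (2 +ℕ q ^ℕ 2) + 1#)
          B = Tr m (δ ^ 2 + δ ^ (1 +ℕ q))
          D = δ ^ (q ^ℕ 2 +ℕ q +ℕ 1) * Tr m δ
          e = q ^ℕ 2 +ℕ q +ℕ 2
          f = λ x → (Tr m x + δ) ^ e + x
          T = λ x → Tr m x + D
      in Permutes f →
         ((A ≈ 0# × B ≈ 0#) →
             IsCompInverse f (λ x → x + ((T x) ^ (2 ^ℕ (2 *ℕ m ∸ℕ 2)) + δ) ^ e))
       × ((B ≈ 0# × ¬ (A ≈ 0#) × ¬ (Σ Carrier (λ y → InFq m y × y ^ 3 ≈ A))) →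
             let d = gcd m 2
                 N = A ^ divBy (2 ^ℕ m ∸ℕ 1) (2 ^ℕ d ∸ℕ 1)
             in IsCompInverse f (λ x → x + (δ + (N * inv (1# + N)) *
                    sumTo (divBy m d) (λ i → inv A ^ divBy (4 ^ℕ (i +ℕ 1) ∸ℕ 1) 3 * (T x) ^ (4 ^ℕ i))) ^ e))
       × (¬ (A * B ≈ 0#) →
             IsCompInverse f (λ x → x + (δ +
                sumTo m (λ i → ((Sshift A B (m ∸ℕ 1 ∸ℕ i)) ^ (2 ^ℕ (i +ℕ 1)) + inv A ^ (2 ^ℕ (i +ℕ 1) ∸ℕ 1) * Sshift A B (i +ℕ 1)) * (T x) ^ (2 ^ℕ i))) ^ e))
theorem4 F isF m 1≤m card δ perm =
  (λ (A≈0 , B≈0) → C.case-A≈0-B≈0 1≤m perm A≈0 B≈0) ,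
  (λ (B≈0 , A≉0 , noncube) → C.B≈0.compInverse perm B≈0 A≉0 1≤m noncube) ,
  (λ AB≉0 → C.A≉0.compInverse perm (λ A≈0 → AB≉0 (R.trans (R.*-congʳ A≈0) (R.zeroˡ _))) 1≤m)
  where
  module C = Cases F isF m card δ
  module R = CommutativeRing F
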